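{- For every positive integer $n$, there exists a type-$1,2$ $\mathrm{LRPA}(n)$, i.e. an $n\times n$ latin square on the symbol set $\{1,\ldots,n\}$ which is simultaneously a type-$1$ and a type-$2$ $\mathrm{RPA}(n)$.
   Context: Let $[n]=\{1,\ldots,n\}$. A retransmission permutation array of order $n$ ($\mathrm{RPA}(n)$) of type $1$ is an $n\times n$ array with entries from $[n]$ such that (i) every row is a permutation of $[n]$, and (ii) for each $1\le i\le n$, the $i\times\lceil n/i\rceil$ rectangle (rows $1,\dots,i$, columns $1,\dots,\lceil n/i\rceil$) in the upper left corner contains all $n$ symbols. Type $2$ is defined identically except that (ii) is required for the $i\times\lceil n/i\rceil$ rectangles in the upper right corner (rows $1,\dots,i$, the last $\lceil n/i\rceil$ columns). An $\mathrm{RPA}(n)$ is called latin ($\mathrm{LRPA}(n)$) if additionally every column is a permutation of $[n]$, i.e. the array is a latin square. -}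

module Defs where

open import Data.Nat using (ℕ; zero; suc; _+_; _∸_; _<_; _≤_)
open import Data.Nat.DivMod using (_/_)
open import Data.Fin using (Fin; toℕ)
open import Data.Product using (_×_; ∃; ∃-syntax; Σ-syntax)
open import Relation.Binary.PropositionalEquality using (_≡_)
open import Function.Definitions using (Bijective)

⌈_/suc_⌉ : ℕ → ℕ → ℕ
⌈ m /suc k ⌉ = (m + k) / suc k

-- An n × n array with entries in [n]; rows, columns and symbols are
-- 0-indexed via Fin n (row r ↔ row toℕ r + 1, symbol s ↔ symbol toℕ s + 1).
Array : ℕ → Set
Array n = Fin n → Fin n → Fin n

RowsArePerms : ∀ {n} → Array n → Set
RowsArePerms {n} A = ∀ (r : Fin n) → Bijective _≡_ _≡_ (λ c → A r c)

ColsArePerms : ∀ {n} → Array n → Set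
ColsArePerms {n} A = ∀ (c : Fin n) → Bijective _≡_ _≡_ (λ r → A r c)

Latin : ∀ {n} → Array n → Set
Latin A = RowsArePerms A × ColsArePerms A

-- (ii) type 1: for each i = suc k ∈ [1, n], the rectangle of rows 1..i and
-- columns 1..⌈n/i⌉ (upper-left) contains every symbol
UpperLeftCond : ∀ {n} → Array n → Set
UpperLeftCond {n} A =
  ∀ (k : ℕ) → k < n → ∀ (s : Fin n) →
    ∃[ r ] ∃[ c ] (toℕ r < suc k × toℕ c < ⌈ n /suc k ⌉ × A r c ≡ s)

UpperRightCond : ∀ {n} → Array n → Set
UpperRightCond {n} A =
  ∀ (k : ℕ) → k < n → ∀ (s : Fin n) →
    ∃[ r ] ∃[ c ] (toℕ r < suc k × n ∸ ⌈ n /suc k ⌉ ≤ toℕ c × A r c ≡ s)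

RPA₁ : ∀ {n} → Array n → Set
RPA₁ A = RowsArePerms A × UpperLeftCond A

RPA₂ : ∀ {n} → Array n → Set
RPA₂ A = RowsArePerms A × UpperRightCond A

LRPA₁₂ : ∀ {n} → Array n → Set
LRPA₁₂ A = Latin A × RPA₁ A × RPA₂ A

{-# OPTIONS --safe #-}
module Submission where

-- Call a symbol alive in row i at time k if it sits there in one of the first
-- size i k cells, where the sizes share the n symbols evenly among the rows
-- 0 , … , k. When a new row is added, each old row evicts its outermost alive cells
-- and the evicted symbols form the (short) new row, so each symbol remains alive in
-- exactly one cell: this is the corner condition for k + 1 rows. The cells of a
-- symbol move strictly towards the edge, so columns never repeat a symbol. Doing
-- this from the left and from the right, the two new rows must be disjoint. That can
-- always be arranged: the left one has only n / (k + 2) symbols, and each row of the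
-- right table keeps at least that many, so it can keep whatever the left one evicts.
--
-- This prescribes both ends of the first half of the rows. Their middle parts are
-- filled row by row with Hall's theorem: few rows lie above and few cells are
-- prescribed, except near row n / 2, where one also uses that a symbol not prescribed
-- in the row already occurs above in the two outermost columns on either side. The
-- other rows carry no condition, and a latin rectangle always extends to a latin
-- square. Orders below 10 are given explicitly.

open import Defs
open import Data.Bool using (Bool; true; false; _∧_; _∨_; not; if_then_else_)
import Data.Bool.Properties as 𝔹
open import Data.Empty using (⊥; ⊥-elim)
open import Data.Fin using (Fin; zero; suc; toℕ; fromℕ<; opposite)
import Data.Fin.Properties as F
open import Data.Fin.Subset.Properties using (anySubset?)
open import Data.List using (List; []; _∷_; _++_; length; take; drop; filter; allFin)
open import Data.List.Membership.DecPropositional using (_∈?_)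
open import Data.List.Membership.Propositional using (_∈_; _∉_)
open import Data.List.Membership.Propositional.Properties
open import Data.List.Properties using (length-take; length-drop; length-++; take++drop≡id; length-tabulate)
import Data.List.Relation.Unary.All as All
open import Data.List.Relation.Unary.Any using (here; there)
open import Data.List.Relation.Unary.Unique.Propositional using (Unique; []; _∷_)
open import Data.List.Relation.Unary.Unique.Propositional.Properties using (++⁺; take⁺; drop⁺; filter⁺; allFin⁺)
open import Data.Nat using (ℕ; zero; suc; _+_; _*_; _∸_; _≤_; _<_; _≤?_; _<?_; _<ᵇ_; z≤n; s≤s; >-nonZero)
open import Data.Nat.DivMod
open import Data.Nat.Properties
open import Data.Nat.Solver using (module +-*-Solver)
open import Data.Product using (Σ; _×_; _,_; proj₁; proj₂; ∃; ∃-syntax; ∃₂)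
open import Data.Sum using (_⊎_; inj₁; inj₂)
open import Data.Vec using (Vec; []; _∷_; lookup; tabulate)
open import Data.Vec.Properties using (lookup∘tabulate)
open import Function using (_∘_; case_of_; id)
open import Function.Definitions using (Bijective)
open import Relation.Binary.PropositionalEquality
open import Relation.Nullary using (¬_; Dec; yes; no; ⌊_⌋; contradiction)
open import Relation.Nullary.Decidable using (_×-dec_; _→-dec_; map′; ¬?; True; toWitness)

-- Half of the rows suffice because `⌈ n / i ⌉` is 2 for all `i` with `n / 2 ≤ i < n`: once every
-- symbol occurs in the two outermost columns on either side, only `i = n` is left, and there a full
-- column does. The delicate point is whether a row can be completed. With `p` prescribed cells and
-- `κ` rows above, Hall's condition is safe as soon as `p + 2κ ≤ n`. Here `p` is about
-- `2n / (κ + 1)`. For `n ≥ 10` the inequality holds from row 2 up to the row before row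
-- `k = ⌊ n / 2 ⌋ - 1`; it fails for `n = 9`, `κ = 2`, which accounts for the threshold 10. In row
-- `k` four cells are prescribed and `4 + 2k` exceeds `n` by two for even `n` and by one for odd
-- `n`. The excess is recovered by discounting occurrences of a symbol above prescribed cells. For
-- odd `n` one more row matters, with a single symbol due at each end. There only the two outermost
-- columns are imposed instead of an exact cell, which is all that the remaining rectangles ask for.

private variable
  m n : ℕ

-- Finite sets of indices, as Boolean predicates

FinSet : ℕ → Set
FinSet n = Fin n → Bool

bit : Bool → ℕ
bit b = if b then 1 else 0

card : FinSet n → ℕ
card {zero}  S = 0
card {suc n} S = bit (S zero) + card (S ∘ suc)

bit≤1 : ∀ b → bit b ≤ 1
bit≤1 true  = ≤-refl
bit≤1 false = z≤n

card-mono : {S T : FinSet n} → (∀ i → S i ≡ true → T i ≡ true) → card S ≤ card T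
card-mono {zero}  S⊆T = z≤n
card-mono {suc n} {S} {T} S⊆T = +-mono-≤ (head (S zero) (T zero) (S⊆T zero)) (card-mono (S⊆T ∘ suc))
  where
  head : ∀ a b → (a ≡ true → b ≡ true) → bit a ≤ bit b
  head false b     _ = z≤n
  head true  true  _ = ≤-refl
  head true  false h with () ← h refl

card-cong : {S T : FinSet n} → (∀ i → S i ≡ T i) → card S ≡ card T
card-cong {zero}  eq = refl
card-cong {suc n} eq = cong₂ (λ b k → bit b + k) (eq zero) (card-cong (eq ∘ suc))

card-≤n : (S : FinSet n) → card S ≤ n
card-≤n {zero}  S = z≤n
card-≤n {suc n} S = +-mono-≤ (bit≤1 (S zero)) (card-≤n (S ∘ suc))

card-full : card {n} (λ _ → true) ≡ n
card-full {zero}  = refl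
card-full {suc n} = cong suc card-full

card-empty : card {n} (λ _ → false) ≡ 0
card-empty {zero}  = refl
card-empty {suc n} = card-empty {n}

interchange : ∀ a b c d → (a + b) + (c + d) ≡ (a + c) + (b + d)
interchange = solve 4 (λ a b c d → (a :+ b) :+ (c :+ d) := (a :+ c) :+ (b :+ d)) refl
  where open +-*-Solver

card-∨-∧ : (S T : FinSet n) →
  card (λ i → S i ∨ T i) + card (λ i → S i ∧ T i) ≡ card S + card T
card-∨-∧ {zero}  S T = refl
card-∨-∧ {suc n} S T = begin
  (bit (s ∨ t) + u) + (bit (s ∧ t) + v)  ≡⟨ interchange (bit (s ∨ t)) u (bit (s ∧ t)) v ⟩
  (bit (s ∨ t) + bit (s ∧ t)) + (u + v)  ≡⟨ cong₂ _+_ (head s t) (card-∨-∧ (S ∘ suc) (T ∘ suc)) ⟩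
  (bit s + bit t) + (card (S ∘ suc) + card (T ∘ suc)) ≡⟨ interchange (bit s) (bit t) _ _ ⟩
  (bit s + card (S ∘ suc)) + (bit t + card (T ∘ suc)) ∎
  where
  open ≡-Reasoning
  s = S zero
  t = T zero
  u = card (λ i → S (suc i) ∨ T (suc i))
  v = card (λ i → S (suc i) ∧ T (suc i))
  head : ∀ a b → bit (a ∨ b) + bit (a ∧ b) ≡ bit a + bit b
  head false false = refl
  head false true  = refl
  head true  false = refl
  head true  true  = refl

card-∖ : (S C : FinSet n) →
  card S ≡ card (λ i → S i ∧ C i) + card (λ i → S i ∧ not (C i))
card-∖ {zero}  S C = refl
card-∖ {suc n} S C = begin
  bit s + card (S ∘ suc)                      ≡⟨ cong₂ _+_ (head s c) (card-∖ (S ∘ suc) (C ∘ suc)) ⟩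
  (bit (s ∧ c) + bit (s ∧ not c)) + (u + v)   ≡⟨ interchange (bit (s ∧ c)) (bit (s ∧ not c)) u v ⟩
  (bit (s ∧ c) + u) + (bit (s ∧ not c) + v)   ∎
  where
  open ≡-Reasoning
  s = S zero
  c = C zero
  u = card (λ i → S (suc i) ∧ C (suc i))
  v = card (λ i → S (suc i) ∧ not (C (suc i)))
  head : ∀ a b → bit a ≡ bit (a ∧ b) + bit (a ∧ not b)
  head false false = refl
  head false true  = refl
  head true  false = refl
  head true  true  = refl

card-complement : (S : FinSet n) → card S + card (not ∘ S) ≡ n
card-complement S = trans (sym (card-∖ (λ _ → true) S)) card-full

_∖_ : FinSet n → Fin n → FinSet n
(S ∖ x) i = S i ∧ not ⌊ i F.≟ x ⌋

card-∖-∈ : (S : FinSet n) (x : Fin n) → S x ≡ true → card S ≡ suc (card (S ∖ x))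
card-∖-∈ {suc n} S zero Sx rewrite Sx =
  cong suc (card-cong λ i → sym (𝔹.∧-identityʳ (S (suc i))))
card-∖-∈ {suc n} S (suc x) Sx = begin
  bit (S zero) + card (S ∘ suc)                       ≡⟨ cong (bit (S zero) +_) (card-∖-∈ (S ∘ suc) x Sx) ⟩
  bit (S zero) + suc (card ((S ∘ suc) ∖ x))           ≡⟨ +-suc (bit (S zero)) _ ⟩
  suc (bit (S zero) + card ((S ∘ suc) ∖ x))           ≡⟨ cong suc (cong₂ (λ b k → bit b + k) (sym (𝔹.∧-identityʳ (S zero))) (card-cong tail)) ⟩
  suc (bit (S zero ∧ true) + card ((S ∖ suc x) ∘ suc)) ∎
  where
  open ≡-Reasoning
  tail : ∀ i → ((S ∘ suc) ∖ x) i ≡ (S ∖ suc x) (suc i)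
  tail i with i F.≟ x
  ... | yes _ = refl
  ... | no  _ = refl

∧-true : ∀ {a b} → a ∧ b ≡ true → a ≡ true × b ≡ true
∧-true {true} {true} _ = refl , refl

∧-intro : ∀ {a b} → a ≡ true → b ≡ true → a ∧ b ≡ true
∧-intro refl refl = refl

true≢false : {A : Set} → ∀ {b} → b ≡ true → b ≡ false → A
true≢false refl ()

not-true : ∀ {b} → not b ≡ true → b ≡ false
not-true {false} _ = refl

∈-dec : (b : Bool) → (b ≡ true) ⊎ (b ≡ false)
∈-dec true  = inj₁ refl
∈-dec false = inj₂ refl

≟-false : {i j : Fin n} → i ≢ j → not ⌊ i F.≟ j ⌋ ≡ true
≟-false {i = i} {j} i≢j with i F.≟ j
... | yes i≡j = contradiction i≡j i≢j
... | no  _   = refl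

≟-false⁻ : {i j : Fin n} → not ⌊ i F.≟ j ⌋ ≡ true → i ≢ j
≟-false⁻ {i = i} {j} h with i F.≟ j
≟-false⁻ () | yes _
... | no i≢j = i≢j

⌊⌋-intro : {P : Set} (P? : Dec P) → P → ⌊ P? ⌋ ≡ true
⌊⌋-intro (yes _) _ = refl
⌊⌋-intro (no ¬p) p = contradiction p ¬p

⌊⌋-elim : {P : Set} (P? : Dec P) → ⌊ P? ⌋ ≡ true → P
⌊⌋-elim (yes p) _ = p

card-injection : (S : FinSet m) (T : FinSet n) (f : ∀ i → S i ≡ true → Fin n) →
  (∀ i p → T (f i p) ≡ true) →
  (∀ i j p q → f i p ≡ f j q → i ≡ j) →
  card S ≤ card T
card-injection {zero} S T f into inj = z≤n
card-injection {suc m} S T f into inj with S zero in eq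
... | false = card-injection (S ∘ suc) T (f ∘ suc) (into ∘ suc)
                (λ i j p q e → F.suc-injective (inj (suc i) (suc j) p q e))
... | true  = subst (suc (card (S ∘ suc)) ≤_) (sym (card-∖-∈ T (f zero eq) (into zero eq)))
                (s≤s (card-injection (S ∘ suc) (T ∖ f zero eq) (f ∘ suc)
                  (λ i p → ∧-intro (into (suc i) p)
                    (≟-false λ e → case inj (suc i) zero p eq e of λ ()))
                  (λ i j p q e → F.suc-injective (inj (suc i) (suc j) p q e))))

card-∷ : (S : FinSet n) (x : Fin n) → S x ≡ false → card (λ i → S i ∨ ⌊ i F.≟ x ⌋) ≡ suc (card S)
card-∷ S x Sx = trans (card-∖-∈ _ x x∈) (cong suc (card-cong eq))
  where
  x∈ : S x ∨ ⌊ x F.≟ x ⌋ ≡ true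
  x∈ with x F.≟ x
  ... | yes _  = 𝔹.∨-zeroʳ (S x)
  ... | no x≢x = contradiction refl x≢x
  eq : ∀ i → ((λ i → S i ∨ ⌊ i F.≟ x ⌋) ∖ x) i ≡ S i
  eq i with i F.≟ x
  ... | no _ = trans (𝔹.∧-identityʳ _) (𝔹.∨-identityʳ (S i))
  ... | yes refl = trans (𝔹.∧-zeroʳ _) (sym Sx)

-- Finite sums

∑ : (Fin n → ℕ) → ℕ
∑ {zero}  f = 0
∑ {suc n} f = f zero + ∑ (f ∘ suc)

∑-mono : {f g : Fin n → ℕ} → (∀ i → f i ≤ g i) → ∑ f ≤ ∑ g
∑-mono {zero}  f≤g = z≤n
∑-mono {suc n} f≤g = +-mono-≤ (f≤g zero) (∑-mono (f≤g ∘ suc))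

∑-mono-< : {f g : Fin n → ℕ} → (∀ i → f i ≤ g i) → ∀ j → f j < g j → ∑ f < ∑ g
∑-mono-< f≤g zero    fj<gj = +-mono-<-≤ fj<gj (∑-mono (f≤g ∘ suc))
∑-mono-< f≤g (suc j) fj<gj = +-mono-≤-< (f≤g zero) (∑-mono-< (f≤g ∘ suc) j fj<gj)

∑-+ : (f g : Fin n → ℕ) → ∑ (λ i → f i + g i) ≡ ∑ f + ∑ g
∑-+ {zero}  f g = refl
∑-+ {suc n} f g = trans (cong (f zero + g zero +_) (∑-+ (f ∘ suc) (g ∘ suc)))
                    (interchange (f zero) (g zero) _ _)

∑-card-swap : (R : Fin m → Fin n → Bool) → ∑ (λ i → card (R i)) ≡ ∑ (λ j → card (λ i → R i j))
∑-card-swap {zero}  {zero}  R = refl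
∑-card-swap {zero}  {suc n} R = ∑-card-swap {zero} {n} (λ ())
∑-card-swap {suc m} {n} R = trans (cong₂ _+_ (card-∑ (R zero)) (∑-card-swap (R ∘ suc)))
                              (sym (∑-+ (bit ∘ R zero) (λ j → card (λ i → R (suc i) j))))
  where
  card-∑ : ∀ {n} (S : FinSet n) → card S ≡ ∑ (bit ∘ S)
  card-∑ {zero}  S = refl
  card-∑ {suc n} S = cong (bit (S zero) +_) (card-∑ (S ∘ suc))

∑-bit-* : (S : FinSet n) (d : ℕ) → ∑ (λ i → if S i then d else 0) ≡ card S * d
∑-bit-* {zero}  S d = refl
∑-bit-* {suc n} S d with S zero
... | true  = cong (d +_) (∑-bit-* (S ∘ suc) d)
... | false = ∑-bit-* (S ∘ suc) d

-- Hall's theorem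

Graph : ℕ → Set
Graph n = Fin n → Fin n → Bool

-- A Hall violator in symmetric form: the neighbours of `S` lie in the complement of `T`, which has
-- fewer than `card S` elements. The symmetry is what makes uncrossing a plain count.
record Deficient {n} (G : Graph n) (S T : FinSet n) : Set where
  constructor deficient
  field
    large   : n < card S + card T
    no-edge : ∀ c s → S c ≡ true → T s ≡ true → G c s ≡ false

deficient? : (G : Graph n) → Dec (∃₂ λ S T → Deficient G S T)
deficient? {n} G = map′ to from (anySubset? λ S → anySubset? λ T → D? (lookup S) (lookup T))
  where
  D? : ∀ S T → Dec (Deficient G S T)
  D? S T = map′ (λ (l , e) → deficient l e) (λ (deficient l e) → l , e)
    ((suc n ≤? card S + card T) ×-dec
     F.all? λ c → F.all? λ s → (S c 𝔹.≟ true) →-dec ((T s 𝔹.≟ true) →-dec (G c s 𝔹.≟ false)))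
  to : _ → ∃₂ λ S T → Deficient G S T
  to (S , T , d) = lookup S , lookup T , d
  from : (∃₂ λ S T → Deficient G S T) → _
  from (S , T , deficient l e) = tabulate S , tabulate T , deficient
    (subst (n <_) (sym (cong₂ _+_ (card-cong (lookup∘tabulate S)) (card-cong (lookup∘tabulate T)))) l)
    (λ c s p q → e c s (trans (sym (lookup∘tabulate S c)) p) (trans (sym (lookup∘tabulate T s)) q))

_∖[_,_] : Graph n → Fin n → Fin n → Graph n
(G ∖[ x , y ]) c s = G c s ∧ not (⌊ c F.≟ x ⌋ ∧ ⌊ s F.≟ y ⌋)

edges : Graph n → ℕ
edges G = ∑ (λ c → card (G c))

removed : (G : Graph n) (x y c s : Fin n) → (G ∖[ x , y ]) c s ≡ false →
          (G c s ≡ false) ⊎ (c ≡ x × s ≡ y)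
removed G x y c s h with G c s
... | false = inj₁ refl
... | true with c F.≟ x | s F.≟ y
...   | yes p | yes q = inj₂ (p , q)
removed G x y c s () | true | yes p | no q
removed G x y c s () | true | no p | _

edges-∖ : (G : Graph n) (x y : Fin n) → G x y ≡ true → edges (G ∖[ x , y ]) < edges G
edges-∖ G x y Gxy = ∑-mono-< {f = card ∘ (G ∖[ x , y ])} {g = card ∘ G}
  (λ c → card-mono {S = (G ∖[ x , y ]) c} {T = G c} λ s → proj₁ ∘ ∧-true {G c s}) x
  (subst (card ((G ∖[ x , y ]) x) <_) (sym (card-∖-∈ (G x) y Gxy)) (s≤s (card-mono step)))
  where
  step : ∀ s → (G ∖[ x , y ]) x s ≡ true → (G x ∖ y) s ≡ true
  step s h with x F.≟ x
  ... | yes _ = h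
  ... | no ¬p = contradiction refl ¬p

-- Rado's argument: if deleting either of the edges (x , y₁), (x , y₂) creates a
-- deficient pair, then uncrossing the two pairs yields one of the original graph.
uncross : (G : Graph n) {x y₁ y₂ : Fin n} → y₁ ≢ y₂ → G x y₁ ≡ true → G x y₂ ≡ true →
  ∀ {S₁ T₁ S₂ T₂} → Deficient (G ∖[ x , y₁ ]) S₁ T₁ → Deficient (G ∖[ x , y₂ ]) S₂ T₂ →
  ∃₂ λ S T → Deficient G S T
uncross {n} G {x} {y₁} {y₂} y₁≢y₂ g₁ g₂ {S₁} {T₁} {S₂} {T₂} (deficient l₁ e₁) (deficient l₂ e₂)
  with ∈-dec (S₁ x ∧ T₁ y₁) | ∈-dec (S₂ x ∧ T₂ y₂)
... | inj₂ f | _ = S₁ , T₁ , deficient l₁ λ c s p q → case removed G x y₁ c s (e₁ c s p q) of λ where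
        (inj₁ h) → h
        (inj₂ (refl , refl)) → true≢false (∧-intro p q) f
... | inj₁ _ | inj₂ f = S₂ , T₂ , deficient l₂ λ c s p q → case removed G x y₂ c s (e₂ c s p q) of λ where
        (inj₁ h) → h
        (inj₂ (refl , refl)) → true≢false (∧-intro p q) f
... | inj₁ t₁ | inj₁ t₂ = conclude
  where
  S₁x = proj₁ (∧-true {S₁ x} t₁)
  T₁y = proj₂ (∧-true {S₁ x} t₁)
  S₂x = proj₁ (∧-true {S₂ x} t₂)
  T₂y = proj₂ (∧-true {S₂ x} t₂)
  -- The edge from `x` to `y₁` survives the deletion of the one to `y₂`, and `x` lies in `S₂`.
  y₁∉T₂ : T₂ y₁ ≢ true
  y₁∉T₂ h with removed G x y₂ x y₁ (e₂ x y₁ S₂x h)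
  ... | inj₁ f       = true≢false g₁ f
  ... | inj₂ (_ , e) = y₁≢y₂ e
  y₂∉T₁ : T₁ y₂ ≢ true
  y₂∉T₁ h with removed G x y₁ x y₂ (e₁ x y₂ S₁x h)
  ... | inj₁ f       = true≢false g₂ f
  ... | inj₂ (_ , e) = y₁≢y₂ (sym e)
  Sᵤ Sᵢ Tᵤ Tᵢ : FinSet n
  Sᵤ i = S₁ i ∨ S₂ i
  Sᵢ i = S₁ i ∧ S₂ i
  Tᵤ i = T₁ i ∨ T₂ i
  Tᵢ i = T₁ i ∧ T₂ i
  ∨-true : ∀ a {b} → a ∨ b ≡ true → (a ≡ true) ⊎ (b ≡ true)
  ∨-true true  _ = inj₁ refl
  ∨-true false h = inj₂ h
  edge-a : ∀ c s → Sᵤ c ≡ true → Tᵢ s ≡ true → G c s ≡ false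
  edge-a c s p q with ∧-true {T₁ s} q | ∨-true (S₁ c) p
  ... | q₁ , q₂ | inj₁ p₁ = case removed G x y₁ c s (e₁ c s p₁ q₁) of λ where
          (inj₁ h) → h
          (inj₂ (_ , refl)) → contradiction q₂ y₁∉T₂
  ... | q₁ , q₂ | inj₂ p₂ = case removed G x y₂ c s (e₂ c s p₂ q₂) of λ where
          (inj₁ h) → h
          (inj₂ (_ , refl)) → contradiction q₁ y₂∉T₁
  edge-b : ∀ c s → (Sᵢ ∖ x) c ≡ true → Tᵤ s ≡ true → G c s ≡ false
  edge-b c s p q with ∧-true {Sᵢ c} p
  ... | p′ , c≢x with ∧-true {S₁ c} p′ | ∨-true (T₁ s) q
  ...   | p₁ , p₂ | inj₁ q₁ = case removed G x y₁ c s (e₁ c s p₁ q₁) of λ where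
            (inj₁ h) → h
            (inj₂ (e , _)) → contradiction e (≟-false⁻ c≢x)
  ...   | p₁ , p₂ | inj₂ q₂ = case removed G x y₂ c s (e₂ c s p₂ q₂) of λ where
            (inj₁ h) → h
            (inj₂ (e , _)) → contradiction e (≟-false⁻ c≢x)
  -- Removing `x` from the intersection costs one, but the two given pairs together exceed `n + n`
  -- by at least two, so one of the uncrossed pairs still exceeds `n`.
  total : suc ((card Sᵤ + card Tᵢ) + (card (Sᵢ ∖ x) + card Tᵤ)) ≡ (card S₁ + card T₁) + (card S₂ + card T₂)
  total = begin
    suc ((card Sᵤ + card Tᵢ) + (card (Sᵢ ∖ x) + card Tᵤ))
      ≡⟨ solve 4 (λ a b c d → con 1 :+ ((a :+ b) :+ (c :+ d)) := (a :+ (con 1 :+ c)) :+ (d :+ b)) refl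
           (card Sᵤ) (card Tᵢ) (card (Sᵢ ∖ x)) (card Tᵤ) ⟩
    (card Sᵤ + suc (card (Sᵢ ∖ x))) + (card Tᵤ + card Tᵢ)
      ≡⟨ cong (λ k → (card Sᵤ + k) + (card Tᵤ + card Tᵢ)) (sym (card-∖-∈ Sᵢ x (∧-intro S₁x S₂x))) ⟩
    (card Sᵤ + card Sᵢ) + (card Tᵤ + card Tᵢ)
      ≡⟨ cong₂ _+_ (card-∨-∧ S₁ S₂) (card-∨-∧ T₁ T₂) ⟩
    (card S₁ + card S₂) + (card T₁ + card T₂)
      ≡⟨ interchange (card S₁) (card S₂) (card T₁) (card T₂) ⟩
    (card S₁ + card T₁) + (card S₂ + card T₂) ∎
    where open ≡-Reasoning
          open +-*-Solver
  conclude : ∃₂ λ S T → Deficient G S T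
  conclude with suc n ≤? card Sᵤ + card Tᵢ | suc n ≤? card (Sᵢ ∖ x) + card Tᵤ
  ... | yes l | _     = Sᵤ , Tᵢ , deficient l edge-a
  ... | no _  | yes l = Sᵢ ∖ x , Tᵤ , deficient l edge-b
  ... | no ¬a | no ¬b = contradiction
          (≤-trans (subst (suc n + suc n ≤_) (sym total) (+-mono-≤ l₁ l₂))
                   (s≤s (+-mono-≤ (≤-pred (≰⇒> ¬a)) (≤-pred (≰⇒> ¬b)))))
          (subst (λ k → ¬ (suc k ≤ suc (n + n))) (sym (+-suc n n)) (<⇒≱ ≤-refl))

record Matching {n} (G : Graph n) : Set where
  constructor matching
  field
    match     : Fin n → Fin n
    injective : ∀ {c c′} → match c ≡ match c′ → c ≡ c′
    edge      : ∀ c → G c (match c) ≡ true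

weaken : (G : Graph n) (x y : Fin n) → Matching (G ∖[ x , y ]) → Matching G
weaken G x y (matching f inj e) = matching f inj (λ c → proj₁ (∧-true {G c (f c)} (e c)))

-- Induction on the number of edges. While some `x` has two neighbours, one of the two deletions is
-- harmless by `uncross`. When no vertex has two, the remaining edges are the matching: a vertex `c`
-- without an edge would be deficient together with all symbols, and two vertices sharing the
-- neighbour `y` together with all symbols but `y`.
hall : (G : Graph n) → ¬ (∃₂ λ S T → Deficient G S T) → Matching G
hall {n} G = go (edges G) G ≤-refl
  where
  go : ∀ fuel (G : Graph n) → edges G ≤ fuel → ¬ (∃₂ λ S T → Deficient G S T) → Matching G
  go fuel G le ok with F.any? (λ x → F.any? λ y₁ → F.any? λ y₂ →
      ¬? (y₁ F.≟ y₂) ×-dec ((G x y₁ 𝔹.≟ true) ×-dec (G x y₂ 𝔹.≟ true)))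
  go zero G le ok | yes (x , y₁ , y₂ , ne , g₁ , g₂) =
    contradiction (≤-trans (edges-∖ G x y₁ g₁) le) λ ()
  go (suc fuel) G le ok | yes (x , y₁ , y₂ , ne , g₁ , g₂)
    with deficient? (G ∖[ x , y₁ ]) | deficient? (G ∖[ x , y₂ ])
  ... | yes (_ , _ , d₁) | yes (_ , _ , d₂) = contradiction (uncross G ne g₁ g₂ d₁ d₂) ok
  ... | no ok₁ | _ = weaken G x y₁ (go fuel (G ∖[ x , y₁ ]) (≤-pred (≤-trans (edges-∖ G x y₁ g₁) le)) ok₁)
  ... | yes _ | no ok₂ = weaken G x y₂ (go fuel (G ∖[ x , y₂ ]) (≤-pred (≤-trans (edges-∖ G x y₂ g₂) le)) ok₂)
  go fuel G le ok | no unique = matching (proj₁ ∘ nbr) inj (proj₂ ∘ nbr)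
    where
    singleton : Fin n → FinSet n
    singleton x i = ⌊ i F.≟ x ⌋
    card-singleton : ∀ x → card (singleton x) ≡ 1
    card-singleton x = trans (card-∷ (λ _ → false) x refl) (cong suc (card-empty {n}))
    nbr : ∀ c → ∃ λ s → G c s ≡ true
    nbr c with F.any? (λ s → G c s 𝔹.≟ true)
    ... | yes r = r
    ... | no ¬r = contradiction (singleton c , (λ _ → true) ,
            deficient (≤-reflexive (sym (cong₂ _+_ (card-singleton c) card-full)))
              λ c′ s p _ → isolated (⌊⌋-elim (c′ F.≟ c) p) s) ok
      where
      isolated : ∀ {c′} → c′ ≡ c → ∀ s → G c′ s ≡ false
      isolated refl s with ∈-dec (G c s)
      ... | inj₁ t = contradiction (s , t) ¬r
      ... | inj₂ f = f
    same : ∀ {x y₁ y₂} → G x y₁ ≡ true → G x y₂ ≡ true → y₁ ≡ y₂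
    same {x} {y₁} {y₂} g₁ g₂ with y₁ F.≟ y₂
    ... | yes e = e
    ... | no ne = contradiction (x , y₁ , y₂ , ne , g₁ , g₂) unique
    inj : ∀ {c c′} → proj₁ (nbr c) ≡ proj₁ (nbr c′) → c ≡ c′
    inj {c} {c′} eq with c F.≟ c′
    ... | yes e = e
    ... | no ne = contradiction (S , T , deficient large no-edge) ok
      where
      y = proj₁ (nbr c)
      S T : FinSet n
      S i = singleton c i ∨ ⌊ i F.≟ c′ ⌋
      T = (λ _ → true) ∖ y
      c′∉ : singleton c c′ ≡ false
      c′∉ = not-true (≟-false (ne ∘ sym))
      large : n < card S + card T
      large = ≤-reflexive (sym (begin
        card S + card T           ≡⟨ cong (_+ card T) (card-∷ (singleton c) c′ c′∉) ⟩
        suc (card (singleton c)) + card T ≡⟨ cong (λ k → suc k + card T) (card-singleton c) ⟩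
        suc (suc (card T))        ≡⟨ cong suc (sym (card-∖-∈ (λ _ → true) y refl)) ⟩
        suc (card (λ (_ : Fin n) → true)) ≡⟨ cong suc card-full ⟩
        suc n                     ∎))
        where open ≡-Reasoning
      no-edge : ∀ d s → S d ≡ true → T s ≡ true → G d s ≡ false
      no-edge d s p q with ∈-dec (G d s)
      ... | inj₂ f = f
      ... | inj₁ g with ∈-dec (singleton c d)
      ...   | inj₁ t = contradiction (same (subst (λ z → G z s ≡ true) (⌊⌋-elim (d F.≟ c) t) g) (proj₂ (nbr c)))
                         (≟-false⁻ q)
      ...   | inj₂ f = contradiction
                (trans (same (subst (λ z → G z s ≡ true) (⌊⌋-elim (d F.≟ c′) (subst (λ b → b ∨ ⌊ d F.≟ c′ ⌋ ≡ true) f p)) g)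
                             (proj₂ (nbr c′))) (sym eq))
                (≟-false⁻ q)

-- Double counting: at least `card S * d` edges leave `S`, all of them end outside `T`, and at most
-- `d` end at each symbol there.
hall-regular : (G : Graph n) (d : ℕ) → 0 < d →
  (∀ c → d ≤ card (G c)) → (∀ s → card (λ c → G c s) ≤ d) → Matching G
hall-regular {n} G d 0<d left right = hall G λ (S , T , deficient large no-edge) →
  <⇒≱ large (≤-trans (+-monoˡ-≤ (card T) (*-cancelʳ-≤ (card S) (card (not ∘ T)) d {{>-nonZero 0<d}} (bound S T no-edge)))
    (≤-reflexive (trans (+-comm (card (not ∘ T)) (card T)) (card-complement T))))
  where
  bound : ∀ S T → (∀ c s → S c ≡ true → T s ≡ true → G c s ≡ false) →
          card S * d ≤ card (not ∘ T) * d
  bound S T no-edge = begin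
    card S * d                                     ≡⟨ sym (∑-bit-* S d) ⟩
    ∑ (λ c → if S c then d else 0)                 ≤⟨ ∑-mono leftward ⟩
    ∑ (λ c → card (λ s → S c ∧ G c s))             ≡⟨ ∑-card-swap (λ c s → S c ∧ G c s) ⟩
    ∑ (λ s → card (λ c → S c ∧ G c s))             ≤⟨ ∑-mono rightward ⟩
    ∑ (λ s → if not (T s) then d else 0)           ≡⟨ ∑-bit-* (not ∘ T) d ⟩
    card (not ∘ T) * d                             ∎
    where
    open ≤-Reasoning
    leftward : ∀ c → (if S c then d else 0) ≤ card (λ s → S c ∧ G c s)
    leftward c with S c
    ... | true  = left c
    ... | false = z≤n
    rightward : ∀ s → card (λ c → S c ∧ G c s) ≤ (if not (T s) then d else 0)
    rightward s with T s in eq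
    ... | false = ≤-trans (card-mono λ c h → proj₂ (∧-true {S c} h)) (right s)
    ... | true  = ≤-reflexive (trans (card-cong λ c → empty c) (card-empty {n}))
      where
      empty : ∀ c → S c ∧ G c s ≡ false
      empty c with S c in p
      ... | false = refl
      ... | true  = no-edge c s p eq

-- Positions in lists

private variable
  A : Set
  xs ys : List A
  x y : A
  σ τ : ℕ

data At {A : Set} : List A → ℕ → A → Set where
  here  : At (x ∷ xs) zero x
  there : At xs σ x → At (y ∷ xs) (suc σ) x

At-< : At xs σ x → σ < length xs
At-< here      = s≤s z≤n
At-< (there p) = s≤s (At-< p)

At-total : (xs : List A) (σ : ℕ) → σ < length xs → ∃[ x ] At xs σ x
At-total (x ∷ xs) zero    _       = x , here
At-total (x ∷ xs) (suc σ) (s≤s h) with y , p ← At-total xs σ h = y , there p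

At-functional : At xs σ x → At xs σ y → x ≡ y
At-functional here      here      = refl
At-functional (there p) (there q) = At-functional p q

At⇒∈ : At xs σ x → x ∈ xs
At⇒∈ here      = here refl
At⇒∈ (there p) = there (At⇒∈ p)

∈⇒At : x ∈ xs → ∃[ σ ] At xs σ x
∈⇒At (here refl) = zero , here
∈⇒At (there p) with σ , q ← ∈⇒At p = suc σ , there q

At-injective : Unique xs → At xs σ x → At xs τ x → σ ≡ τ
At-injective _       here      here      = refl
At-injective (h ∷ _) here      (there q) = contradiction refl (All.lookup h (At⇒∈ q))
At-injective (h ∷ _) (there p) here      = contradiction refl (All.lookup h (At⇒∈ p))
At-injective (_ ∷ u) (there p) (there q) = cong suc (At-injective u p q)

At-drop⁻ : ∀ k (xs : List A) → At (drop k xs) σ x → At xs (k + σ) x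
At-drop⁻ zero    xs       p = p
At-drop⁻ (suc k) (y ∷ xs) p = there (At-drop⁻ k xs p)

At-drop⁺ : ∀ k (xs : List A) → At xs (k + σ) x → At (drop k xs) σ x
At-drop⁺ zero    xs       p         = p
At-drop⁺ (suc k) (y ∷ xs) (there p) = At-drop⁺ k xs p

At-take⁻ : ∀ k (xs : List A) → At (take k xs) σ x → σ < k × At xs σ x
At-take⁻ (suc k) (y ∷ xs) here = s≤s z≤n , here
At-take⁻ (suc k) (y ∷ xs) (there p) with h , q ← At-take⁻ k xs p = s≤s h , there q

At-take⁺ : ∀ k (xs : List A) → σ < k → At xs σ x → At (take k xs) σ x
At-take⁺ (suc k) (y ∷ xs) _       here      = here
At-take⁺ (suc k) (y ∷ xs) (s≤s h) (there p) = there (At-take⁺ k xs h p)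

At-++ˡ : At xs σ x → At (xs ++ ys) σ x
At-++ˡ here      = here
At-++ˡ (there p) = there (At-++ˡ p)

At-++ʳ : ∀ (xs : List A) → At ys σ x → At (xs ++ ys) (length xs + σ) x
At-++ʳ []       p = p
At-++ʳ (_ ∷ xs) p = there (At-++ʳ xs p)

At-++⁻ : ∀ (xs : List A) → At (xs ++ ys) σ x → At xs σ x ⊎ ∃[ τ ] (σ ≡ length xs + τ × At ys τ x)
At-++⁻ []       p    = inj₂ (_ , refl , p)
At-++⁻ (_ ∷ xs) here = inj₁ here
At-++⁻ (_ ∷ xs) (there p) with At-++⁻ xs p
... | inj₁ q              = inj₁ (there q)
... | inj₂ (τ , refl , q) = inj₂ (τ , refl , q)

-- Lists without repetition and rearrangements of their beginning

unique-length-≤ : Unique xs → (∀ {x} → x ∈ xs → x ∈ ys) → length xs ≤ length ys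
unique-length-≤ [] _ = z≤n
unique-length-≤ {xs = x ∷ xs} (x∉ ∷ u) sub with us , vs , refl ← ∈-∃++ (sub (here refl)) =
  subst (suc (length xs) ≤_) (sym len)
    (s≤s (unique-length-≤ u λ {z} z∈ → delete z (All.lookup x∉ z∈ ∘ sym) (sub (there z∈))))
  where
  len : length (us ++ x ∷ vs) ≡ suc (length (us ++ vs))
  len = trans (length-++ us) (trans (+-suc (length us) (length vs)) (cong suc (sym (length-++ us))))
  delete : ∀ z → z ≢ x → z ∈ us ++ x ∷ vs → z ∈ us ++ vs
  delete z z≢x p with ∈-++⁻ us p
  ... | inj₁ q           = ∈-++⁺ˡ q
  ... | inj₂ (here e)    = contradiction e z≢x
  ... | inj₂ (there q)   = ∈-++⁺ʳ us q

-- The only freedom a table row has: its alive cells, the first `k`, may be permuted, while the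
-- evicted symbols behind them stay in their columns.
Moves : ℕ → List A → List A → Set
Moves k xs ys = ∀ {σ x} → At xs σ x → ∃[ τ ] (At ys τ x × ((σ < k × τ < k) ⊎ σ ≡ τ))

Moves-++ : ∀ {k} (xs ys : List A) {ws : List A} → length xs ≡ k → length ys ≡ k →
  (∀ {x} → x ∈ xs → x ∈ ys) → Moves k (xs ++ ws) (ys ++ ws)
Moves-++ xs ys refl len sub p with At-++⁻ xs p
... | inj₁ q with τ , r ← ∈⇒At (sub (At⇒∈ q)) = τ , At-++ˡ r , inj₁ (At-< q , subst (τ <_) len (At-< r))
... | inj₂ (τ , refl , q) = _ , At-++ʳ ys q , inj₂ (cong (_+ τ) (sym len))

module Reorder {n : ℕ} (avoid : List (Fin n)) where

  _∈ₐ?_ = _∈?_ (F._≟_ {n})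

  front : List (Fin n) → List (Fin n)
  front xs = filter (_∈ₐ? avoid) xs ++ filter (¬? ∘ (_∈ₐ? avoid)) xs

  front-⊆ : ∀ {xs x} → x ∈ front xs → x ∈ xs
  front-⊆ {xs} p with ∈-++⁻ (filter (_∈ₐ? avoid) xs) p
  ... | inj₁ q = proj₁ (∈-filter⁻ (_∈ₐ? avoid) q)
  ... | inj₂ q = proj₁ (∈-filter⁻ (¬? ∘ (_∈ₐ? avoid)) q)

  front-⊇ : ∀ {xs x} → x ∈ xs → x ∈ front xs
  front-⊇ {xs} {x} p with x ∈ₐ? avoid
  ... | yes q = ∈-++⁺ˡ (∈-filter⁺ (_∈ₐ? avoid) p q)
  ... | no ¬q = ∈-++⁺ʳ (filter (_∈ₐ? avoid) xs) (∈-filter⁺ (¬? ∘ (_∈ₐ? avoid)) p ¬q)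

  front-unique : ∀ {xs} → Unique xs → Unique (front xs)
  front-unique {xs} u = ++⁺ (filter⁺ (_∈ₐ? avoid) u) (filter⁺ (¬? ∘ (_∈ₐ? avoid)) u)
    λ (p , q) → proj₂ (∈-filter⁻ (¬? ∘ (_∈ₐ? avoid)) {xs = xs} q) (proj₂ (∈-filter⁻ (_∈ₐ? avoid) {xs = xs} p))

  front-length : ∀ {xs} → Unique xs → length (front xs) ≡ length xs
  front-length {xs} u = ≤-antisym (unique-length-≤ (front-unique u) (front-⊆ {xs})) (unique-length-≤ u front-⊇)

  -- As `xs` has no repetition, at most `length avoid` of its entries are to be avoided, and those
  -- come first.
  front-avoids : ∀ {xs σ x} → Unique xs → length avoid ≤ σ → At (front xs) σ x → x ∉ avoid
  front-avoids {xs} u le p with At-++⁻ (filter (_∈ₐ? avoid) xs) p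
  ... | inj₁ q = contradiction (≤-trans (s≤s le) (≤-trans (At-< q)
                   (unique-length-≤ (filter⁺ (_∈ₐ? avoid) u) (proj₂ ∘ ∈-filter⁻ (_∈ₐ? avoid) {xs = xs})))) (<⇒≱ ≤-refl)
  ... | inj₂ (_ , _ , q) = proj₂ (∈-filter⁻ (¬? ∘ (_∈ₐ? avoid)) {xs = xs} (At⇒∈ q))

  reorder : ℕ → List (Fin n) → List (Fin n)
  reorder k xs = front (take k xs) ++ drop k xs

  module _ {k : ℕ} {xs : List (Fin n)} (k≤ : k ≤ length xs) (u : Unique xs) where

    private
      take-len : length (take k xs) ≡ k
      take-len = trans (length-take k xs) (m≤n⇒m⊓n≡m k≤)

      front-len : length (front (take k xs)) ≡ k
      front-len = trans (front-length (take⁺ k u)) take-len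

    reorder-moves : Moves k xs (reorder k xs)
    reorder-moves = subst (λ zs → Moves k zs (reorder k xs)) (take++drop≡id k xs)
      (Moves-++ (take k xs) (front (take k xs)) take-len front-len front-⊇)

    reorder-moves⁻ : Moves k (reorder k xs) xs
    reorder-moves⁻ = subst (Moves k (reorder k xs)) (take++drop≡id k xs)
      (Moves-++ (front (take k xs)) (take k xs) front-len take-len front-⊆)

    reorder-unique : Unique (reorder k xs)
    reorder-unique = ++⁺ (front-unique (take⁺ k u)) (drop⁺ k u) disjoint
      where
      disjoint : ∀ {x} → ¬ (x ∈ front (take k xs) × x ∈ drop k xs)
      disjoint (p , q) with σ , a ← ∈⇒At (front-⊆ p) | τ , b ← ∈⇒At q with At-take⁻ k xs a
      ... | σ<k , a′ = <⇒≱ σ<k (subst (k ≤_) (sym (At-injective u a′ (At-drop⁻ k xs b))) (m≤m+n k τ))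

    reorder-length : length (reorder k xs) ≡ length xs
    reorder-length = begin
      length (front (take k xs) ++ drop k xs)           ≡⟨ length-++ (front (take k xs)) ⟩
      length (front (take k xs)) + length (drop k xs)   ≡⟨ cong₂ _+_ front-len (length-drop k xs) ⟩
      k + (length xs ∸ k)                               ≡⟨ m+[n∸m]≡n k≤ ⟩
      length xs                                         ∎
      where open ≡-Reasoning

    reorder-avoids : ∀ {σ x} → length avoid ≤ σ → σ < k → At (reorder k xs) σ x → x ∉ avoid
    reorder-avoids {σ} le σ<k p with At-++⁻ (front (take k xs)) p
    ... | inj₁ q = front-avoids (take⁺ k u) le q
    ... | inj₂ (τ , e , _) = contradiction (subst (_≤ σ) front-len (subst (length (front (take k xs)) ≤_) (sym e) (m≤m+n _ τ))) (<⇒≱ σ<k)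

sumTo : ℕ → (ℕ → ℕ) → ℕ
sumTo zero    f = 0
sumTo (suc j) f = sumTo j f + f j

-- The retransmission tables

module Tables (n : ℕ) where

  extra : ℕ → ℕ → ℕ
  extra i ρ = if i <ᵇ ρ then 1 else 0

  -- The number of symbols held by row i when the n symbols are shared out
  -- evenly among the rows 0 , … , k.
  size : ℕ → ℕ → ℕ
  size i k = n / suc k + extra i (n % suc k)

  extra-< : ∀ {i ρ} → i < ρ → extra i ρ ≡ 1
  extra-< {i} {ρ} i<ρ with i <ᵇ ρ in eq
  ... | true  = refl
  ... | false = contradiction (<⇒<ᵇ i<ρ) (subst (¬_ ∘ Data.Bool.T) (sym eq) λ ())

  extra-≥ : ∀ {i ρ} → ρ ≤ i → extra i ρ ≡ 0
  extra-≥ {i} {ρ} ρ≤i with i <ᵇ ρ in eq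
  ... | false = refl
  ... | true  = contradiction (<ᵇ⇒< i ρ (subst Data.Bool.T (sym eq) _)) (≤⇒≯ ρ≤i)

  extra-≤1 : ∀ i ρ → extra i ρ ≤ 1
  extra-≤1 i ρ with i <ᵇ ρ
  ... | true  = ≤-refl
  ... | false = z≤n

  extra-mono : ∀ {i ρ ρ′} → ρ ≤ ρ′ → extra i ρ ≤ extra i ρ′
  extra-mono {i} {ρ} {ρ′} le with i <? ρ
  ... | yes h = ≤-reflexive (trans (extra-< h) (sym (extra-< (≤-trans h le))))
  ... | no ¬h = subst (_≤ extra i ρ′) (sym (extra-≥ (≮⇒≥ ¬h))) z≤n

  quotient-≤-size : ∀ i k → n / suc k ≤ size i k
  quotient-≤-size i k = m≤m+n _ _

  size-≤-ceil : ∀ i k → size i k ≤ ⌈ n /suc k ⌉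
  size-≤-ceil i k with i <? n % suc k
  ... | no ¬h = subst (_≤ ⌈ n /suc k ⌉) (sym (trans (cong (n / suc k +_) (extra-≥ (≮⇒≥ ¬h))) (+-identityʳ _)))
                  (/-monoˡ-≤ (suc k) (m≤m+n n k))
  ... | yes h = subst (_≤ ⌈ n /suc k ⌉) (m*n/n≡m (size i k) (suc k)) (/-monoˡ-≤ (suc k) le)
    where
    open ≤-Reasoning
    q = n / suc k
    le : size i k * suc k ≤ n + k
    le = begin
      size i k * suc k             ≡⟨ cong (λ e → (q + e) * suc k) (extra-< h) ⟩
      (q + 1) * suc k              ≡⟨ solve 2 (λ q k → (q :+ con 1) :* (con 1 :+ k) := (con 1 :+ q :* (con 1 :+ k)) :+ k) refl q k ⟩
      (1 + q * suc k) + k          ≤⟨ +-monoˡ-≤ k (+-monoˡ-≤ (q * suc k) (≤-trans (s≤s z≤n) h)) ⟩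
      (n % suc k + q * suc k) + k  ≡⟨ cong (_+ k) (sym (m≡m%n+[m/n]*n n (suc k))) ⟩
      n + k                        ∎
      where open +-*-Solver

  -- If the quotient drops, the drop pays for a possible extra symbol. If it stays the same, the
  -- remainder cannot grow, so no row gains an extra symbol.
  size-step : ∀ i k → size i (suc k) ≤ size i k
  size-step i k with m≤n⇒m<n∨m≡n (/-monoʳ-≤ n {suc (suc k)} {suc k} (n≤1+n (suc k)))
  ... | inj₁ q′<q = ≤-trans (+-monoʳ-≤ (n / suc (suc k)) (extra-≤1 i (n % suc (suc k))))
                     (≤-trans (≤-reflexive (+-comm _ 1)) (≤-trans q′<q (m≤m+n _ _)))
  ... | inj₂ q′≡q = +-mono-≤ (≤-reflexive q′≡q) (extra-mono ρ′≤ρ)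
    where
    open ≤-Reasoning
    q = n / suc k
    ρ′≤ρ : n % suc (suc k) ≤ n % suc k
    ρ′≤ρ = +-cancelʳ-≤ (q * suc k) _ _ (begin
      n % suc (suc k) + q * suc k            ≤⟨ +-monoʳ-≤ (n % suc (suc k)) (*-monoʳ-≤ q (n≤1+n (suc k))) ⟩
      n % suc (suc k) + q * suc (suc k)      ≡⟨ cong (λ z → n % suc (suc k) + z * suc (suc k)) (sym q′≡q) ⟩
      n % suc (suc k) + n / suc (suc k) * suc (suc k) ≡⟨ sym (m≡m%n+[m/n]*n n (suc (suc k))) ⟩
      n                                      ≡⟨ m≡m%n+[m/n]*n n (suc k) ⟩
      n % suc k + q * suc k                  ∎)

  size-antitone : ∀ i {j k} → j ≤ k → size i k ≤ size i j
  size-antitone i {j} {zero} z≤n = ≤-refl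
  size-antitone i {j} {suc k} j≤ with m≤n⇒m<n∨m≡n j≤
  ... | inj₁ (s≤s j≤k) = ≤-trans (size-step i k) (size-antitone i j≤k)
  ... | inj₂ refl      = ≤-refl

  size-last : ∀ k → size k k ≡ n / suc k
  size-last k = trans (cong (n / suc k +_) (extra-≥ (≤-pred (m%n<n n (suc k))))) (+-identityʳ _)

  size-sum : ∀ k → sumTo (suc k) (λ i → size i k) ≡ n
  size-sum k = begin
    sumTo (suc k) (λ i → size i k)      ≡⟨ split (suc k) ⟩
    suc k * q + sumTo (suc k) (λ i → extra i ρ) ≡⟨ cong₂ _+_ (*-comm (suc k) q) (extras (suc k) (<⇒≤ (m%n<n n (suc k)))) ⟩
    q * suc k + ρ                       ≡⟨ +-comm (q * suc k) ρ ⟩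
    ρ + q * suc k                       ≡⟨ sym (m≡m%n+[m/n]*n n (suc k)) ⟩
    n                                   ∎
    where
    open ≡-Reasoning
    q = n / suc k
    ρ = n % suc k
    split : ∀ j → sumTo j (λ i → size i k) ≡ j * q + sumTo j (λ i → extra i ρ)
    split zero    = refl
    split (suc j) = trans (cong (_+ size j k) (split j))
      (solve 4 (λ a b c d → (a :+ b) :+ (c :+ d) := (c :+ a) :+ (b :+ d)) refl (j * q) _ q (extra j ρ))
      where open +-*-Solver
    all : ∀ j → j ≤ ρ → sumTo j (λ i → extra i ρ) ≡ j
    all zero    _ = refl
    all (suc j) h = trans (cong₂ _+_ (all j (<⇒≤ h)) (extra-< h)) (+-comm j 1)
    extras : ∀ j → ρ ≤ j → sumTo j (λ i → extra i ρ) ≡ ρ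
    extras j h with m≤n⇒m<n∨m≡n h
    ... | inj₂ e = subst (λ j → sumTo j (λ i → extra i ρ) ≡ ρ) e (all ρ ≤-refl)
    extras (suc j) h | inj₁ (s≤s h′) = trans (cong₂ _+_ (extras j h′) (extra-≥ h′)) (+-identityʳ ρ)

  -- The number of cells of row `i` at its creation; evicted symbols stay written there. Rows 0 and
  -- 1 are created together at time 1, so row 0 starts with `size 0 1` cells instead of `n`.
  width : ℕ → ℕ
  width zero    = size 0 1
  width (suc i) = n / suc (suc i)

  size-≤-width : ∀ {i k} → 1 ≤ k → i ≤ k → size i k ≤ width i
  size-≤-width {zero}  1≤k _  = size-antitone 0 1≤k
  size-≤-width {suc i} _   le = ≤-trans (size-antitone (suc i) le) (≤-reflexive (size-last (suc i)))

  Table : Set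
  Table = ℕ → List (Fin n)

  -- Position σ of row i is alive at time k when σ < size i k.
  record Side (k : ℕ) (D : Table) : Set where
    field
      row-length : ∀ {i} → i ≤ k → length (D i) ≡ width i
      row-unique : ∀ {i} → i ≤ k → Unique (D i)
      cover      : ∀ {j} → 1 ≤ j → j ≤ k → ∀ s →
                   ∃[ i ] ∃[ σ ] (i ≤ j × σ < size i j × At (D i) σ s)
      -- The bound is the end of the alive part of row `i` and not just `σ`, so that it survives
      -- every permutation of the alive cells.
      inward     : ∀ {i i′ σ σ′ s} → i ≤ k → i′ ≤ k → i ≢ i′ →
                   σ < size i k → At (D i) σ s → At (D i′) σ′ s → size i k ≤ σ′
      col-unique : ∀ {i i′ σ s} → i ≤ k → i′ ≤ k → At (D i) σ s → At (D i′) σ s → i ≡ i′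

    -- Two alive copies in different rows would give the cycle `σ < size i k ≤ σ′ < size i′ k ≤ σ`.
    alive-unique : ∀ {i i′ σ σ′ s} → i ≤ k → i′ ≤ k →
      σ < size i k → σ′ < size i′ k → At (D i) σ s → At (D i′) σ′ s → i ≡ i′
    alive-unique {i} {i′} i≤ i′≤ h h′ p p′ with i ≟ i′
    ... | yes e = e
    ... | no ne = contradiction
      (≤-trans h (≤-trans (inward i≤ i′≤ ne h p p′)
        (≤-trans (<⇒≤ h′) (inward i′≤ i≤ (ne ∘ sym) h′ p′ p)))) (<⇒≱ ≤-refl)

  -- Adding a row of evicted symbols to a table

  module _ {k : ℕ} (1≤k : 1 ≤ k) {D : Table} (SD : Side k D) where
    open Side SD

    -- Earlier times `j` see at least `size i k` cells of row `i`, so permuting the first `size i k`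
    -- cells never takes a symbol out of an earlier rectangle. A column clash cannot arise either:
    -- an alive cell has all other copies of its symbol beyond the alive part of its row, and dead
    -- cells have not moved.
    Side-reorder : (D₁ : Table) →
      (∀ {i} → i ≤ k → length (D₁ i) ≡ length (D i)) →
      (∀ {i} → i ≤ k → Unique (D₁ i)) →
      (∀ {i} → i ≤ k → Moves (size i k) (D i) (D₁ i)) →
      (∀ {i} → i ≤ k → Moves (size i k) (D₁ i) (D i)) →
      Side k D₁
    Side-reorder D₁ len uni to from = record
      { row-length = λ i≤ → trans (len i≤) (row-length i≤)
      ; row-unique = uni
      ; cover      = cover₁
      ; inward     = inward₁
      ; col-unique = col₁
      }
      where
      cover₁ : ∀ {j} → 1 ≤ j → j ≤ k → ∀ s → ∃[ i ] ∃[ σ ] (i ≤ j × σ < size i j × At (D₁ i) σ s)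
      cover₁ 1≤j j≤k s with i , σ , i≤j , σ< , p ← cover 1≤j j≤k s with to (≤-trans i≤j j≤k) p
      ... | τ , q , inj₁ (_ , τ<) = i , τ , i≤j , ≤-trans τ< (size-antitone i j≤k) , q
      ... | τ , q , inj₂ refl     = i , τ , i≤j , σ< , q
      inward₁ : ∀ {i i′ σ σ′ s} → i ≤ k → i′ ≤ k → i ≢ i′ →
                σ < size i k → At (D₁ i) σ s → At (D₁ i′) σ′ s → size i k ≤ σ′
      inward₁ {i} {i′} {σ} {σ′} {s} i≤ i′≤ ne σ< p p′ = from-old (from i≤ p)
        where
        from-old : ∃[ τ ] (At (D i) τ s × ((σ < size i k × τ < size i k) ⊎ σ ≡ τ)) → size i k ≤ σ′
        from-old (τ , q , e) = conclude (from i′≤ p′)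
          where
          τ< : τ < size i k
          τ< = case e of λ where
            (inj₁ (_ , h)) → h
            (inj₂ refl)    → σ<
          conclude : ∃[ τ′ ] (At (D i′) τ′ s × ((σ′ < size i′ k × τ′ < size i′ k) ⊎ σ′ ≡ τ′)) → size i k ≤ σ′
          conclude (τ′ , q′ , inj₂ refl)       = inward i≤ i′≤ ne τ< q q′
          conclude (τ′ , q′ , inj₁ (_ , τ′<)) = contradiction (alive-unique i≤ i′≤ τ< τ′< q q′) ne
      col₁ : ∀ {i i′ σ s} → i ≤ k → i′ ≤ k → At (D₁ i) σ s → At (D₁ i′) σ s → i ≡ i′
      col₁ {i} {i′} {σ} i≤ i′≤ p p′ with i ≟ i′
      ... | yes e = e
      ... | no ne with from i≤ p | from i′≤ p′
      ...   | _ , _ , inj₁ (σ< , _) | _ = contradiction (inward₁ i≤ i′≤ ne σ< p p′) (<⇒≱ σ<)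
      ...   | _ , _ , inj₂ _ | _ , _ , inj₁ (σ< , _) = contradiction (inward₁ i′≤ i≤ (ne ∘ sym) σ< p′ p) (<⇒≱ σ<)
      ...   | _ , q , inj₂ refl | _ , q′ , inj₂ refl = col-unique i≤ i′≤ q q′

    -- The cells of row `i` that are alive at time `k` but no longer at time `k + 1`.
    segment : ℕ → List (Fin n)
    segment i = drop (size i (suc k)) (take (size i k) (D i))

    evicted : ℕ → List (Fin n)
    evicted zero    = []
    evicted (suc j) = evicted j ++ segment j

    ∈-segment⁻ : ∀ {i s} → s ∈ segment i → ∃[ σ ] (size i (suc k) ≤ σ × σ < size i k × At (D i) σ s)
    ∈-segment⁻ {i} p with τ , a ← ∈⇒At p
      with σ< , b ← At-take⁻ (size i k) (D i) (At-drop⁻ (size i (suc k)) (take (size i k) (D i)) a)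
      = _ , m≤m+n _ τ , σ< , b

    ∈-segment⁺ : ∀ {i σ s} → size i (suc k) ≤ σ → σ < size i k → At (D i) σ s → s ∈ segment i
    ∈-segment⁺ {i} {σ} {s} le σ< p = At⇒∈ (At-drop⁺ {σ = σ ∸ size i (suc k)} (size i (suc k)) (take (size i k) (D i))
      (subst (λ τ → At (take (size i k) (D i)) τ s) (sym (m+[n∸m]≡n le)) (At-take⁺ (size i k) (D i) σ< p)))

    ∈-evicted⁻ : ∀ j {s} → s ∈ evicted j → ∃[ i ] (i < j × s ∈ segment i)
    ∈-evicted⁻ (suc j) p with ∈-++⁻ (evicted j) p
    ... | inj₁ q with i , i<j , r ← ∈-evicted⁻ j q = i , m≤n⇒m≤1+n i<j , r
    ... | inj₂ q = j , ≤-refl , q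

    ∈-evicted⁺ : ∀ j {i s} → i < j → s ∈ segment i → s ∈ evicted j
    ∈-evicted⁺ (suc j) i<j p with m≤n⇒m<n∨m≡n i<j
    ... | inj₁ (s≤s h) = ∈-++⁺ˡ (∈-evicted⁺ j h p)
    ... | inj₂ refl    = ∈-++⁺ʳ (evicted j) p

    evicted-unique : ∀ j → j ≤ suc k → Unique (evicted j)
    evicted-unique zero    _ = []
    evicted-unique (suc j) h = ++⁺ (evicted-unique j (<⇒≤ h))
      (drop⁺ (size j (suc k)) (take⁺ (size j k) (row-unique (≤-pred h)))) disjoint
      where
      disjoint : ∀ {s} → ¬ (s ∈ evicted j × s ∈ segment j)
      disjoint (p , q) with i , i<j , r ← ∈-evicted⁻ j p
        with _ , _ , a< , a ← ∈-segment⁻ {i} r | _ , _ , b< , b ← ∈-segment⁻ {j} q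
        = <⇒≢ i<j (alive-unique (≤-trans (<⇒≤ i<j) (≤-pred h)) (≤-pred h) a< b< a b)

    segment-length : ∀ {i} → i ≤ k → length (segment i) + size i (suc k) ≡ size i k
    segment-length {i} i≤ = begin
      length (segment i) + size i (suc k)
        ≡⟨ cong (_+ size i (suc k)) (length-drop (size i (suc k)) (take (size i k) (D i))) ⟩
      (length (take (size i k) (D i)) ∸ size i (suc k)) + size i (suc k)
        ≡⟨ cong (λ l → (l ∸ size i (suc k)) + size i (suc k)) (trans (length-take (size i k) (D i)) (m≤n⇒m⊓n≡m fits)) ⟩
      (size i k ∸ size i (suc k)) + size i (suc k)
        ≡⟨ m∸n+n≡m (size-step i k) ⟩
      size i k ∎
      where
      open ≡-Reasoning
      fits : size i k ≤ length (D i)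
      fits = subst (size i k ≤_) (sym (row-length i≤)) (size-≤-width 1≤k i≤)

    -- The sizes add up to `n` both at time `k` and at time `k + 1`, so what the old rows lose is
    -- exactly the share of the new row.
    evicted-length : length (evicted (suc k)) ≡ n / suc (suc k)
    evicted-length = +-cancelʳ-≡ (sumTo (suc k) (λ i → size i (suc k))) _ _ (begin
      length (evicted (suc k)) + sumTo (suc k) (λ i → size i (suc k)) ≡⟨ go (suc k) ≤-refl ⟩
      sumTo (suc k) (λ i → size i k)                    ≡⟨ size-sum k ⟩
      n                                                 ≡⟨ sym (size-sum (suc k)) ⟩
      sumTo (suc k) (λ i → size i (suc k)) + size (suc k) (suc k)
        ≡⟨ +-comm _ (size (suc k) (suc k)) ⟩
      size (suc k) (suc k) + sumTo (suc k) (λ i → size i (suc k))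
        ≡⟨ cong (_+ sumTo (suc k) (λ i → size i (suc k))) (size-last (suc k)) ⟩
      n / suc (suc k) + sumTo (suc k) (λ i → size i (suc k)) ∎)
      where
      open ≡-Reasoning
      go : ∀ j → j ≤ suc k → length (evicted j) + sumTo j (λ i → size i (suc k)) ≡ sumTo j (λ i → size i k)
      go zero    _ = refl
      go (suc j) h = trans (cong (_+ (sumTo j (λ i → size i (suc k)) + size j (suc k))) (length-++ (evicted j)))
        (trans (solve 4 (λ a b c d → (a :+ b) :+ (c :+ d) := (a :+ c) :+ (b :+ d)) refl
                  (length (evicted j)) (length (segment j)) (sumTo j (λ i → size i (suc k))) (size j (suc k)))
          (cong₂ _+_ (go j (<⇒≤ h)) (segment-length (≤-pred h))))
        where open +-*-Solver

    extend : Table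
    extend i with i ≟ suc k
    ... | yes _ = evicted (suc k)
    ... | no _  = D i

    extend-old : ∀ {i} → i ≤ k → extend i ≡ D i
    extend-old {i} i≤ with i ≟ suc k
    ... | yes refl = contradiction i≤ (<⇒≱ ≤-refl)
    ... | no _     = refl

    extend-new : extend (suc k) ≡ evicted (suc k)
    extend-new with suc k ≟ suc k
    ... | yes _ = refl
    ... | no ne = contradiction refl ne

    private
      old-or-new : ∀ {i} → i ≤ suc k → i ≤ k ⊎ i ≡ suc k
      old-or-new le with m≤n⇒m<n∨m≡n le
      ... | inj₁ (s≤s h) = inj₁ h
      ... | inj₂ e       = inj₂ e

    -- An evicted symbol had its only alive copy in a segment, so no old row holds it among the
    -- cells that it keeps. Every old row keeps at least `n / suc (suc k)` cells, the length of the
    -- new row; hence the new copy is strictly closer to the edge than all old ones.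
    evicted-outward : ∀ {i σ s} → i ≤ k → s ∈ evicted (suc k) → At (D i) σ s → size i (suc k) ≤ σ × n / suc (suc k) ≤ σ
    evicted-outward {i} {σ} i≤ s∈ p with i₀ , s≤s i₀≤ , r ← ∈-evicted⁻ (suc k) s∈
      with σ₀ , ge , lt , q ← ∈-segment⁻ {i₀} r with i₀ ≟ i
    ... | yes refl rewrite At-injective (row-unique i≤) p q = ge , ≤-trans (quotient-≤-size i (suc k)) ge
    ... | no ne with size i (suc k) ≤? σ
    ...   | yes le = le , ≤-trans (quotient-≤-size i (suc k)) le
    ...   | no ¬le = contradiction (alive-unique i₀≤ i≤ lt (≤-trans (≰⇒> ¬le) (size-step i k)) q p) ne

    Side-extend : Side (suc k) extend
    Side-extend = record
      { row-length = len
      ; row-unique = uni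
      ; cover      = cov
      ; inward     = inw
      ; col-unique = col
      }
      where
      len : ∀ {i} → i ≤ suc k → length (extend i) ≡ width i
      len le with old-or-new le
      ... | inj₁ i≤   = trans (cong length (extend-old i≤)) (row-length i≤)
      ... | inj₂ refl = trans (cong length extend-new) evicted-length
      uni : ∀ {i} → i ≤ suc k → Unique (extend i)
      uni le with old-or-new le
      ... | inj₁ i≤   = subst Unique (sym (extend-old i≤)) (row-unique i≤)
      ... | inj₂ refl = subst Unique (sym extend-new) (evicted-unique (suc k) ≤-refl)
      old : ∀ {i σ s} → i ≤ k → At (extend i) σ s → At (D i) σ s
      old {σ = σ} {s} i≤ = subst (λ xs → At xs σ s) (extend-old i≤)
      old⁻ : ∀ {i σ s} → i ≤ k → At (D i) σ s → At (extend i) σ s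
      old⁻ {σ = σ} {s} i≤ = subst (λ xs → At xs σ s) (sym (extend-old i≤))
      new : ∀ {σ s} → At (extend (suc k)) σ s → s ∈ evicted (suc k)
      new {σ} {s} p = At⇒∈ (subst (λ xs → At xs σ s) extend-new p)
      cov : ∀ {j} → 1 ≤ j → j ≤ suc k → ∀ s → ∃[ i ] ∃[ σ ] (i ≤ j × σ < size i j × At (extend i) σ s)
      cov 1≤j j≤ s with old-or-new j≤
      ... | inj₁ j≤k with i , σ , i≤j , σ< , p ← cover 1≤j j≤k s = i , σ , i≤j , σ< , old⁻ (≤-trans i≤j j≤k) p
      ... | inj₂ refl with i , σ , i≤k , σ< , p ← cover 1≤k ≤-refl s with size i (suc k) ≤? σ
      ...   | no ¬le = i , σ , m≤n⇒m≤1+n i≤k , ≰⇒> ¬le , old⁻ i≤k p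
      ...   | yes le with τ , q ← ∈⇒At (∈-evicted⁺ (suc k) (s≤s i≤k) (∈-segment⁺ {i} le σ< p)) =
                suc k , τ , ≤-refl ,
                subst (τ <_) (trans evicted-length (sym (size-last (suc k)))) (At-< q) ,
                subst (λ xs → At xs τ s) (sym extend-new) q
      inw : ∀ {i i′ σ σ′ s} → i ≤ suc k → i′ ≤ suc k → i ≢ i′ →
            σ < size i (suc k) → At (extend i) σ s → At (extend i′) σ′ s → size i (suc k) ≤ σ′
      inw {i} {i′} {σ′ = σ′} le le′ ne σ< p p′ with old-or-new le | old-or-new le′
      ... | inj₁ i≤   | inj₁ i′≤  = ≤-trans (size-step i k) (inward i≤ i′≤ ne (≤-trans σ< (size-step i k)) (old i≤ p) (old i′≤ p′))
      ... | inj₁ i≤   | inj₂ refl = contradiction (proj₁ (evicted-outward i≤ (new p′) (old i≤ p))) (<⇒≱ σ<)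
      ... | inj₂ refl | inj₁ i′≤  = subst (_≤ σ′) (sym (size-last (suc k))) (proj₂ (evicted-outward i′≤ (new p) (old i′≤ p′)))
      ... | inj₂ refl | inj₂ refl = contradiction refl ne
      new-< : ∀ {σ s} → At (extend (suc k)) σ s → σ < n / suc (suc k)
      new-< {σ} p = subst (σ <_) (trans (cong length extend-new) evicted-length) (At-< p)
      col : ∀ {i i′ σ s} → i ≤ suc k → i′ ≤ suc k → At (extend i) σ s → At (extend i′) σ s → i ≡ i′
      col le le′ p p′ with old-or-new le | old-or-new le′
      ... | inj₁ i≤   | inj₁ i′≤  = col-unique i≤ i′≤ (old i≤ p) (old i′≤ p′)
      ... | inj₁ i≤   | inj₂ refl = contradiction (proj₂ (evicted-outward i≤ (new p′) (old i≤ p))) (<⇒≱ (new-< p′))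
      ... | inj₂ refl | inj₁ i′≤  = contradiction (proj₂ (evicted-outward i′≤ (new p) (old i′≤ p′))) (<⇒≱ (new-< p))
      ... | inj₂ refl | inj₂ refl = refl

  -- The link between the old and the new table is kept because conditions relating the two sides
  -- must be carried along: `from` transports disjointness of opposite rows, and `evicts` settles
  -- the middle column when row 2 is created.
  record Successor (k : ℕ) (D : Table) (avoid : List (Fin n)) : Set where
    field
      table  : Table
      side   : Side (suc k) table
      to     : ∀ {i} → i ≤ k → Moves (size i k) (D i) (table i)
      from   : ∀ {i} → i ≤ k → Moves (size i k) (table i) (D i)
      evicts : ∀ {i σ s} → i ≤ k → size i (suc k) ≤ σ → σ < size i k → At (table i) σ s → s ∈ table (suc k)
      avoids : length avoid ≤ n / suc (suc k) → ∀ {s} → s ∈ table (suc k) → s ∉ avoid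

  -- Only n / (k + 2) symbols are to be avoided and every row keeps at least that
  -- many, so the unwanted symbols of a row fit into the part that it keeps.
  successor : ∀ {k D} → 1 ≤ k → Side k D → (avoid : List (Fin n)) → Successor k D avoid
  successor {k} {D} 1≤k SD avoid = record
    { table  = D₂
    ; side   = Side-extend 1≤k S₁
    ; to     = λ {i} i≤ → subst (Moves (size i k) (D i)) (sym (old i≤)) (reorder-moves (fits i≤) (row-unique i≤))
    ; from   = λ {i} i≤ → subst (λ xs → Moves (size i k) xs (D i)) (sym (old i≤)) (reorder-moves⁻ (fits i≤) (row-unique i≤))
    ; evicts = λ {i} {σ} {s} i≤ le lt p → subst (s ∈_) (sym new)
                 (∈-evicted⁺ 1≤k S₁ (suc k) (s≤s i≤)
                   (∈-segment⁺ 1≤k S₁ le lt (subst (λ xs → At xs σ s) (old i≤) p)))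
    ; avoids = λ le {s} s∈ → avoids′ le (subst (s ∈_) new s∈)
    }
    where
    open Side SD
    open Reorder avoid
    fits : ∀ {i} → i ≤ k → size i k ≤ length (D i)
    fits {i} i≤ = subst (size i k ≤_) (sym (row-length i≤)) (size-≤-width 1≤k i≤)
    D₁ : Table
    D₁ i = reorder (size i k) (D i)
    S₁ : Side k D₁
    S₁ = Side-reorder 1≤k SD D₁
      (λ i≤ → reorder-length (fits i≤) (row-unique i≤))
      (λ i≤ → reorder-unique (fits i≤) (row-unique i≤))
      (λ i≤ → reorder-moves (fits i≤) (row-unique i≤))
      (λ i≤ → reorder-moves⁻ (fits i≤) (row-unique i≤))
    D₂ : Table
    D₂ = extend 1≤k S₁
    old : ∀ {i} → i ≤ k → D₂ i ≡ D₁ i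
    old = extend-old 1≤k S₁
    new : D₂ (suc k) ≡ evicted 1≤k S₁ (suc k)
    new = extend-new 1≤k S₁
    avoids′ : length avoid ≤ n / suc (suc k) → ∀ {s} → s ∈ evicted 1≤k S₁ (suc k) → s ∉ avoid
    avoids′ le s∈ with i , s≤s i≤ , r ← ∈-evicted⁻ 1≤k S₁ (suc k) s∈
      with σ , ge , lt , p ← ∈-segment⁻ 1≤k S₁ {i} r =
      reorder-avoids (fits i≤) (row-unique i≤) (≤-trans le (≤-trans (quotient-≤-size i (suc k)) ge)) lt p

  -- The table with two rows

  half : ℕ
  half = size 0 1

  half+half : half + n / 2 ≡ n
  half+half = trans (cong (half +_) (sym (size-last 1))) (size-sum 1)

  initial : Table
  initial zero    = take half (allFin n)
  -- From row 2 on this is a default value; `Side 1` speaks of rows 0 and 1 only.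
  initial (suc _) = drop half (allFin n)

  allFin-length : length (allFin n) ≡ n
  allFin-length = length-tabulate {n = n} (λ i → i)

  half-≤ : half ≤ length (allFin n)
  half-≤ = subst (half ≤_) (trans half+half (sym allFin-length)) (m≤m+n half (n / 2))

  initial-disjoint : ∀ {s} → s ∈ initial 0 → s ∈ initial 1 → ⊥
  initial-disjoint p q with σ , a ← ∈⇒At p | τ , b ← ∈⇒At q with At-take⁻ half (allFin n) a
  ... | σ< , a′ = <⇒≱ σ< (subst (half ≤_) (sym (At-injective (allFin⁺ n) a′ (At-drop⁻ half (allFin n) b))) (m≤m+n half τ))

  Side-initial : Side 1 initial
  Side-initial = record
    { row-length = len
    ; row-unique = uni
    ; cover      = cov
    ; inward     = λ i≤ i′≤ ne _ p p′ → contradiction (same-row i≤ i′≤ p p′) ne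
    ; col-unique = same-row
    }
    where
    len : ∀ {i} → i ≤ 1 → length (initial i) ≡ width i
    len {zero}        _ = trans (length-take half (allFin n)) (m≤n⇒m⊓n≡m half-≤)
    len {suc zero}    _ = trans (length-drop half (allFin n))
      (trans (cong (_∸ half) (trans allFin-length (sym half+half))) (m+n∸m≡n half (n / 2)))
    len {suc (suc _)} (s≤s ())
    uni : ∀ {i} → i ≤ 1 → Unique (initial i)
    uni {zero}  _ = take⁺ half (allFin⁺ n)
    uni {suc _} _ = drop⁺ half (allFin⁺ n)
    same-row : ∀ {i i′ σ σ′ s} → i ≤ 1 → i′ ≤ 1 → At (initial i) σ s → At (initial i′) σ′ s → i ≡ i′
    same-row {zero}     {zero}     _ _ _ _ = refl
    same-row {suc zero} {suc zero} _ _ _ _ = refl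
    same-row {zero}     {suc _}    _ _ p q = ⊥-elim (initial-disjoint (At⇒∈ p) (At⇒∈ q))
    same-row {suc _}    {zero}     _ _ p q = ⊥-elim (initial-disjoint (At⇒∈ q) (At⇒∈ p))
    same-row {suc (suc _)} (s≤s ())
    same-row {suc zero} {suc (suc _)} _ (s≤s ())
    cov : ∀ {j} → 1 ≤ j → j ≤ 1 → ∀ s → ∃[ i ] ∃[ σ ] (i ≤ j × σ < size i j × At (initial i) σ s)
    cov (s≤s z≤n) (s≤s z≤n) s with σ , p ← ∈⇒At (∈-allFin s) with half ≤? σ
    ... | no ¬le = 0 , σ , z≤n , ≰⇒> ¬le , At-take⁺ half (allFin n) (≰⇒> ¬le) p
    ... | yes le = 1 , σ ∸ half , ≤-refl ,
          subst ((σ ∸ half) <_) (trans (len {1} ≤-refl) (sym (size-last 1))) (At-< q) , q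
      where
      q : At (drop half (allFin n)) (σ ∸ half) s
      q = At-drop⁺ half (allFin n) (subst (λ τ → At (allFin n) τ s) (sym (m+[n∸m]≡n le)) p)

  -- The left and the right table together

  swap₀₁ : ℕ → ℕ
  swap₀₁ zero          = 1
  swap₀₁ (suc zero)    = 0
  swap₀₁ (suc (suc i)) = suc (suc i)

  swap₀₁-involutive : ∀ i → swap₀₁ (swap₀₁ i) ≡ i
  swap₀₁-involutive zero          = refl
  swap₀₁-involutive (suc zero)    = refl
  swap₀₁-involutive (suc (suc i)) = refl

  swap₀₁-≤ : ∀ {i k} → 1 ≤ k → i ≤ k → swap₀₁ i ≤ k
  swap₀₁-≤ {zero}        1≤k _  = 1≤k
  swap₀₁-≤ {suc zero}    _   _  = z≤n
  swap₀₁-≤ {suc (suc i)} _   le = le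

  swap₀₁-fixes : ∀ {i} → 2 ≤ i → swap₀₁ i ≡ i
  swap₀₁-fixes (s≤s (s≤s _)) = refl

  -- Row i of the left table fills the left end of row i of the array, while row i
  -- of the right table fills the right end of row swap₀₁ i, read from the right.
  -- With this swap the first two rows are filled completely, also for odd n, where
  -- position half ∸ 1 of both tables' rows 0 is the middle column.
  record Tables₂ (k : ℕ) : Set where
    field
      left right : Table
      left-side  : Side k left
      right-side : Side k right
      disjoint   : ∀ {i s} → i ≤ k → s ∈ left i → s ∈ right (swap₀₁ i) → ⊥
      middle     : 2 ≤ k → ∀ {s} → At (left 0) (half ∸ 1) s → At (right 0) (half ∸ 1) s → ⊥

  tables-combine : size 0 2 < half → ∀ {k} (T : Tables₂ (suc k)) →
    (nl : Successor (suc k) (Tables₂.left T) []) →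
    Successor (suc k) (Tables₂.right T) (Successor.table nl (suc (suc k))) →
    Tables₂ (suc (suc k))
  tables-combine shrinks {k} T nl nr = record
    { left       = table nl
    ; right      = table nr
    ; left-side  = side nl
    ; right-side = side nr
    ; disjoint   = dis
    ; middle     = λ _ → mid
    }
    where
    open Successor
    open Tables₂ T
    1≤k : 1 ≤ suc k
    1≤k = s≤s z≤n
    fresh : ∀ {s} → s ∈ table nl (suc (suc k)) → s ∈ table nr (suc (suc k)) → ⊥
    fresh p q = avoids nr (≤-reflexive (Side.row-length (side nl) ≤-refl)) q p
    back : ∀ {k D D′} → Moves k D′ D → ∀ {s : Fin n} → s ∈ D′ → s ∈ D
    back f p with _ , a ← ∈⇒At p with _ , b , _ ← f a = At⇒∈ b
    dis : ∀ {i s} → i ≤ suc (suc k) → s ∈ table nl i → s ∈ table nr (swap₀₁ i) → ⊥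
    dis {i} le p q with m≤n⇒m<n∨m≡n le
    ... | inj₁ (s≤s i≤) = disjoint i≤ (back (from nl i≤) p) (back (from nr (swap₀₁-≤ 1≤k i≤)) q)
    ... | inj₂ refl     = fresh p q
    size≤half∸1 : size 0 2 ≤ half ∸ 1
    size≤half∸1 = ∸-monoˡ-≤ 1 shrinks
    half∸1< : half ∸ 1 < half
    half∸1< = ≤-reflexive (m+[n∸m]≡n {1} (≤-trans (s≤s z≤n) shrinks))
    -- From time 2 on position `half ∸ 1` of row 0 is dead, so its symbol is fixed.
    stays : ∀ {D D′ s} → 2 ≤ suc k → Moves (size 0 (suc k)) D D′ → At D (half ∸ 1) s → At D′ (half ∸ 1) s
    stays 2≤k f p with f p
    ... | _ , q , inj₂ refl     = q
    ... | _ , _ , inj₁ (lt , _) = contradiction (≤-trans lt (size-antitone 0 2≤k)) (≤⇒≯ size≤half∸1)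
    mid : ∀ {s} → At (table nl 0) (half ∸ 1) s → At (table nr 0) (half ∸ 1) s → ⊥
    mid p q with m≤n⇒m<n∨m≡n 1≤k
    ... | inj₁ 2≤k  = middle 2≤k (stays 2≤k (from nl z≤n) p) (stays 2≤k (from nr z≤n) q)
    -- At the step from time 1 to time 2 the cells at `half ∸ 1` are evicted on both sides, so equal
    -- symbols there would occur in both new rows.
    ... | inj₂ refl = fresh (evicts nl z≤n size≤half∸1 half∸1< p) (evicts nr z≤n size≤half∸1 half∸1< q)

  tables : size 0 2 < half → ∀ k → Tables₂ (suc k)
  tables shrinks zero = record
    -- Both sides may start alike: through the swap each of the first two rows of the array receives
    -- the two complementary halves of the symbols.
    { left       = initial
    ; right      = initial
    ; left-side  = Side-initial
    ; right-side = Side-initial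
    ; disjoint   = dis
    ; middle     = λ { (s≤s ()) }
    }
    where
    dis : ∀ {i s} → i ≤ 1 → s ∈ initial i → s ∈ initial (swap₀₁ i) → ⊥
    dis {zero}     _ p q = initial-disjoint p q
    dis {suc zero} _ p q = initial-disjoint q p
    dis {suc (suc _)} (s≤s ())
  tables shrinks (suc k) = tables-combine shrinks T nl (successor (s≤s z≤n) right-side _)
    where
    T = tables shrinks k
    open Tables₂ T
    nl : Successor (suc k) left []
    nl = successor (s≤s z≤n) left-side []

-- Latin rectangles and their extension by a row

card-⊆-empty : (S : FinSet n) → (∀ i → S i ≡ true → ⊥) → card S ≡ 0
card-⊆-empty {n} S none = n≤0⇒n≡0 (≤-trans (card-mono {S = S} {T = λ _ → false} λ i p → ⊥-elim (none i p)) (≤-reflexive (card-empty {n})))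

card-≤-suc : (S : FinSet n) (x : Fin n) → card S ≤ suc (card (S ∖ x))
card-≤-suc S x with ∈-dec (S x)
... | inj₁ p = ≤-reflexive (card-∖-∈ S x p)
... | inj₂ p = m≤n⇒m≤1+n (card-mono {S = S} {T = S ∖ x} λ i q → ∧-intro q (≟-false λ { refl → true≢false q p }))

injective⇒surjective : (f : Fin n → Fin n) → (∀ {i j} → f i ≡ f j → i ≡ j) → ∀ s → ∃[ c ] f c ≡ s
injective⇒surjective {n} f inj s with F.any? (λ c → f c F.≟ s)
... | yes r = r
... | no ¬r = contradiction
  (card-injection (λ (_ : Fin n) → true) ((λ _ → true) ∖ s) (λ i _ → f i)
    (λ i _ → ≟-false λ e → ¬r (i , e)) (λ i j _ _ e → inj e))
  (<⇒≱ (≤-reflexive (sym (card-∖-∈ (λ (_ : Fin n) → true) s refl))))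

injective⇒bijective : (f : Fin n → Fin n) → (∀ {i j} → f i ≡ f j → i ≡ j) → Bijective _≡_ _≡_ f
injective⇒bijective f inj = inj , λ s → let c , e = injective⇒surjective f inj s in c , λ { refl → e }

Rows : ℕ → Set
Rows n = ℕ → Fin n → Fin n

record Rectangle {n} (k : ℕ) (A : Rows n) : Set where
  field
    row-injective : ∀ {i} → i < k → ∀ {c c′} → A i c ≡ A i c′ → c ≡ c′
    col-injective : ∀ {i i′} → i < k → i′ < k → ∀ {c} → A i c ≡ A i′ c → i ≡ i′

_[_≔_] : Rows n → ℕ → (Fin n → Fin n) → Rows n
(A [ k ≔ g ]) i with i ≟ k
... | yes _ = g
... | no _  = A i

≔-old : (A : Rows n) {k : ℕ} {g : Fin n → Fin n} → ∀ {i} → i < k → (A [ k ≔ g ]) i ≡ A i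
≔-old A {k} {i = i} i<k with i ≟ k
... | yes refl = contradiction i<k (<⇒≱ ≤-refl)
... | no _     = refl

≔-new : (A : Rows n) {k : ℕ} {g : Fin n → Fin n} → (A [ k ≔ g ]) k ≡ g
≔-new A {k} with k ≟ k
... | yes _ = refl
... | no ne = contradiction refl ne

record NewRow {n} (k : ℕ) (A : Rows n) : Set where
  constructor newRow
  field
    row       : Fin n → Fin n
    injective : ∀ {c c′} → row c ≡ row c′ → c ≡ c′
    fresh     : ∀ {i} → i < k → ∀ c → A i c ≢ row c

Rectangle-≔ : ∀ {k} {A : Rows n} → Rectangle k A → (r : NewRow k A) → Rectangle (suc k) (A [ k ≔ NewRow.row r ])
Rectangle-≔ {k = k} {A} RA (newRow g inj fresh) = record { row-injective = row ; col-injective = col }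
  where
  open Rectangle RA
  row : ∀ {i} → i < suc k → ∀ {c c′} → (A [ k ≔ g ]) i c ≡ (A [ k ≔ g ]) i c′ → c ≡ c′
  row (s≤s i≤k) eq with m≤n⇒m<n∨m≡n i≤k
  ... | inj₁ i<k rewrite ≔-old A {g = g} i<k = row-injective i<k eq
  ... | inj₂ refl rewrite ≔-new A {k} {g} = inj eq
  col : ∀ {i i′} → i < suc k → i′ < suc k → ∀ {c} → (A [ k ≔ g ]) i c ≡ (A [ k ≔ g ]) i′ c → i ≡ i′
  col (s≤s i≤) (s≤s i′≤) {c} eq with m≤n⇒m<n∨m≡n i≤ | m≤n⇒m<n∨m≡n i′≤
  ... | inj₁ i<   | inj₁ i′<  rewrite ≔-old A {g = g} i< | ≔-old A {g = g} i′< = col-injective i< i′< eq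
  ... | inj₁ i<   | inj₂ refl rewrite ≔-old A {g = g} i< | ≔-new A {k} {g} = contradiction eq (fresh i< c)
  ... | inj₂ refl | inj₁ i′<  rewrite ≔-new A {k} {g} | ≔-old A {g = g} i′< = contradiction (sym eq) (fresh i′< c)
  ... | inj₂ refl | inj₂ refl = refl

present : ℕ → Rows n → Fin n → Fin n → Bool
present k A c s = ⌊ F.any? (λ (i : Fin k) → A (toℕ i) c F.≟ s) ⌋

present⁺ : ∀ {k} {A : Rows n} {i c s} → i < k → A i c ≡ s → present k A c s ≡ true
present⁺ {k = k} {A} {i} {c} {s} i<k e =
  ⌊⌋-intro (F.any? (λ (i : Fin k) → A (toℕ i) c F.≟ s)) (fromℕ< i<k , trans (cong (λ j → A j c) (F.toℕ-fromℕ< i<k)) e)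

present⁻ : ∀ {k} {A : Rows n} {c s} → present k A c s ≡ true → ∃[ i ] A (toℕ {k} i) c ≡ s
present⁻ {k = k} {A} {c} {s} = ⌊⌋-elim (F.any? (λ (i : Fin k) → A (toℕ i) c F.≟ s))

absent⇒fresh : ∀ {k} {A : Rows n} {i c s} → not (present k A c s) ≡ true → i < k → A i c ≢ s
absent⇒fresh {k = k} {A} {i} h i<k e = true≢false (present⁺ {k = k} {A} {i} i<k e) (not-true h)

not-false : ∀ {b} → not b ≡ false → b ≡ true
not-false {true} _ = refl

∧-false-left : ∀ {a b} → a ∧ b ≡ false → b ≡ true → a ≡ false
∧-false-left {false} _ _ = refl
∧-false-left {true} p q = true≢false q p

symbols-bound : ∀ {k} {A : Rows n} {c} (T : FinSet n) → (∀ s → T s ≡ true → present k A c s ≡ true) → card T ≤ k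
symbols-bound {k = k} {A} {c} T h = subst (card T ≤_) card-full
  (card-injection T (λ (_ : Fin k) → true) (λ s p → proj₁ (present⁻ {k = k} {A} (h s p))) (λ _ _ → refl)
    λ s s′ p p′ e → trans (sym (proj₂ (present⁻ {k = k} {A} (h s p))))
      (trans (cong (λ i → A (toℕ i) c) e) (proj₂ (present⁻ {k = k} {A} (h s′ p′)))))

-- Each of the `k` rows holds `s` in at most one column.
columns-bound : ∀ {k} {A : Rows n} {s} → Rectangle k A → (S : FinSet n) →
  (∀ c → S c ≡ true → present k A c s ≡ true) → card S ≤ k
columns-bound {k = k} {A} RA S h = subst (card S ≤_) card-full
  (card-injection S (λ (_ : Fin k) → true) (λ c p → proj₁ (present⁻ {k = k} {A} (h c p))) (λ _ _ → refl)
    λ c c′ p p′ e → Rectangle.row-injective RA (F.toℕ<n (proj₁ (present⁻ {k = k} {A} (h c p))))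
      (trans (proj₂ (present⁻ {k = k} {A} (h c p)))
        (trans (sym (proj₂ (present⁻ {k = k} {A} (h c′ p′)))) (cong (λ i → A (toℕ i) c′) (sym e)))))

-- One of the at most `k` occurrences of `s` is spent on the column `x` outside `S`. This gain of
-- one decides the tight cases below.
columns-bound₁ : ∀ {k} {A : Rows n} {s} → Rectangle k A → (S : FinSet n) →
  (∀ c → S c ≡ true → present k A c s ≡ true) →
  ∀ {x} → S x ≡ false → present k A x s ≡ true → suc (card S) ≤ k
columns-bound₁ {k = k} {A} {s} RA S h {x} x∉ px = subst (_≤ k) (card-∷ S x x∉) (columns-bound RA _ both)
  where
  both : ∀ c → S c ∨ ⌊ c F.≟ x ⌋ ≡ true → present k A c s ≡ true
  both c p with S c in eq | c F.≟ x
  ... | true  | _        = h c eq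
  ... | false | yes refl = px
  both c () | false | no _

-- Every column misses exactly `n ∸ k` symbols and every symbol is missing from exactly `n ∸ k`
-- columns, so the graph of admissible entries is regular.
extend-row : ∀ {k} {A : Rows n} → k < n → Rectangle k A → NewRow k A
extend-row {n} {k} {A} k<n RA = newRow match injective
  λ i<k c → absent⇒fresh {k = k} {A} (edge c) i<k
  where
  open Rectangle RA
  G : Graph n
  G c s = not (present k A c s)
  left : ∀ c → n ∸ k ≤ card (G c)
  left c = m≤n+o⇒m∸n≤o n k (subst (_≤ k + card (G c)) (card-complement (present k A c))
    (+-monoˡ-≤ (card (G c)) (symbols-bound {k = k} {A} (present k A c) λ _ p → p)))
  position : ∀ s (i : Fin k) → ∃[ c ] A (toℕ i) c ≡ s
  position s i = injective⇒surjective (A (toℕ i)) (row-injective (F.toℕ<n i)) s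
  right : ∀ s → card (λ c → G c s) ≤ n ∸ k
  right s = m+n≤o⇒m≤o∸n _ (≤-trans (+-monoʳ-≤ (card (λ c → G c s)) k≤)
    (≤-reflexive (trans (+-comm _ (card (λ c → present k A c s))) (card-complement (λ c → present k A c s)))))
    where
    k≤ : k ≤ card (λ c → present k A c s)
    k≤ = subst (_≤ card (λ c → present k A c s)) card-full
      (card-injection (λ (_ : Fin k) → true) (λ c → present k A c s) (λ i _ → proj₁ (position s i))
        (λ i _ → present⁺ {k = k} {A} (F.toℕ<n i) (proj₂ (position s i)))
        λ i j _ _ e → F.toℕ-injective (col-injective (F.toℕ<n i) (F.toℕ<n j)
          (trans (proj₂ (position s i)) (trans (sym (proj₂ (position s j))) (cong (A (toℕ j)) (sym e))))))
  open Matching (hall-regular G (n ∸ k) (m<n⇒0<n∸m k<n) left right)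

-- In a deficient pair the prescribed columns and the prescribed symbols account for at most
-- `card C`. If free columns and free symbols both remain, all these symbols lie above any one of
-- these columns, so there are at most `k`; and all these columns have any one of the symbols `t`
-- above them. The last hypothesis bounds exactly this situation.
extend-row-prescribed : ∀ {k} {A : Rows n} → Rectangle k A →
  (C : FinSet n) (v : Fin n → Fin n) →
  (∀ {c c′} → C c ≡ true → C c′ ≡ true → v c ≡ v c′ → c ≡ c′) →
  (∀ {c} → C c ≡ true → ∀ {i} → i < k → A i c ≢ v c) →
  (∀ t (S : FinSet n) → (∀ c → C c ≡ true → v c ≢ t) →
    (∀ c → S c ≡ true → C c ≡ false × present k A c t ≡ true) →
    ∀ {c₀} → S c₀ ≡ true → card C + (card S + k) ≤ n) →
  Σ (NewRow k A) λ r → ∀ c → C c ≡ true → NewRow.row r c ≡ v c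
extend-row-prescribed {n} {k} {A} RA C v v-inj v-fresh room =
  newRow match injective fresh , prescribed
  where
  P : FinSet n
  P s = ⌊ F.any? (λ c → (C c 𝔹.≟ true) ×-dec (v c F.≟ s)) ⌋
  P⁺ : ∀ {c} → C c ≡ true → P (v c) ≡ true
  P⁺ {c} p = ⌊⌋-intro (F.any? (λ c′ → (C c′ 𝔹.≟ true) ×-dec (v c′ F.≟ v c))) (c , p , refl)
  P⁻ : ∀ {s} → P s ≡ true → ∃[ c ] (C c ≡ true × v c ≡ s)
  P⁻ {s} = ⌊⌋-elim (F.any? (λ c′ → (C c′ 𝔹.≟ true) ×-dec (v c′ F.≟ s)))
  G : Graph n
  -- A prescribed column has its value as only neighbour, which forces every perfect matching to
  -- respect it.
  G c s = if C c then ⌊ s F.≟ v c ⌋ else not (P s) ∧ not (present k A c s)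

  not-deficient : ¬ (∃₂ λ S T → Deficient G S T)
  not-deficient (S , T , deficient large no-edge) = <⇒≱ large (begin
    card S + card T                              ≡⟨ cong₂ _+_ (card-∖ S C) (card-∖ T P) ⟩
    (card Sᵢ + card Sₒ) + (card Tᵢ + card Tₒ)    ≡⟨ interchange (card Sᵢ) (card Sₒ) (card Tᵢ) (card Tₒ) ⟩
    (card Sᵢ + card Tᵢ) + (card Sₒ + card Tₒ)    ≤⟨ +-monoˡ-≤ _ inside ⟩
    card C + (card Sₒ + card Tₒ)                 ≤⟨ outside ⟩
    n                                            ∎)
    where
    open ≤-Reasoning
    Sᵢ Sₒ Tᵢ Tₒ V : FinSet n
    Sᵢ c = S c ∧ C c
    Sₒ c = S c ∧ not (C c)
    Tᵢ s = T s ∧ P s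
    Tₒ s = T s ∧ not (P s)
    -- The prescribed symbols in `T` come from columns in `V`. A prescribed column in `S` is not in
    -- `V`, since the edge to its own value would join `S` and `T`.
    V c = C c ∧ T (v c)
    Tᵢ≤V : card Tᵢ ≤ card V
    Tᵢ≤V = card-injection Tᵢ V (λ s p → proj₁ (P⁻ (proj₂ (∧-true {T s} p))))
      (λ s p → let c , Cc , e = P⁻ (proj₂ (∧-true {T s} p)) in
        ∧-intro Cc (subst (λ z → T z ≡ true) (sym e) (proj₁ (∧-true {T s} p))))
      (λ s s′ p p′ e → trans (sym (proj₂ (proj₂ (P⁻ (proj₂ (∧-true {T s} p))))))
        (trans (cong v e) (proj₂ (proj₂ (P⁻ (proj₂ (∧-true {T s′} p′)))))))
    Sᵢ≤ : card Sᵢ ≤ card (λ c → C c ∧ not (T (v c)))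
    Sᵢ≤ = card-mono step
      where
      step : ∀ c → Sᵢ c ≡ true → C c ∧ not (T (v c)) ≡ true
      step c p with ∧-true {S c} p | T (v c) in eq
      ... | Sc , Cc | false = ∧-intro Cc refl
      ... | Sc , Cc | true  = true≢false (edge c Cc) (no-edge c (v c) Sc eq)
        where
        edge : ∀ c → C c ≡ true → G c (v c) ≡ true
        edge c Cc rewrite Cc = ⌊⌋-intro (v c F.≟ v c) refl
    inside : card Sᵢ + card Tᵢ ≤ card C
    inside = ≤-trans (+-mono-≤ Sᵢ≤ Tᵢ≤V)
      (≤-reflexive (trans (+-comm _ (card V)) (sym (card-∖ C (T ∘ v)))))
    edgeless : ∀ {c s} → Sₒ c ≡ true → Tₒ s ≡ true → present k A c s ≡ true
    edgeless {c} {s} p q with ∧-true {S c} p | ∧-true {T s} q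
    ... | Sc , ¬C | Ts , ¬P with no-edge c s Sc Ts
    ...   | e rewrite not-true ¬C | ¬P = not-false e
    outside : card C + (card Sₒ + card Tₒ) ≤ n
    outside with F.any? (λ c → Sₒ c 𝔹.≟ true) | F.any? (λ s → Tₒ s 𝔹.≟ true)
    ... | no none | _ = begin
      card C + (card Sₒ + card Tₒ)  ≡⟨ cong (λ z → card C + (z + card Tₒ)) (card-⊆-empty Sₒ λ c p → none (c , p)) ⟩
      card C + card Tₒ              ≤⟨ +-mono-≤ C≤P (card-mono λ s p → proj₂ (∧-true {T s} p)) ⟩
      card P + card (not ∘ P)       ≡⟨ card-complement P ⟩
      n                             ∎
      where
      C≤P : card C ≤ card P
      C≤P = card-injection C P (λ c _ → v c) (λ _ → P⁺) (λ _ _ p q → v-inj p q)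
    ... | yes _ | no none = begin
      card C + (card Sₒ + card Tₒ)  ≡⟨ cong (λ z → card C + (card Sₒ + z)) (card-⊆-empty Tₒ λ s p → none (s , p)) ⟩
      card C + (card Sₒ + 0)        ≡⟨ cong (card C +_) (+-identityʳ _) ⟩
      card C + card Sₒ              ≤⟨ +-monoʳ-≤ (card C) (card-mono λ c p → proj₂ (∧-true {S c} p)) ⟩
      card C + card (not ∘ C)       ≡⟨ card-complement C ⟩
      n                             ∎
    ... | yes (c₀ , p₀) | yes (t , q₀) = begin
      card C + (card Sₒ + card Tₒ)  ≤⟨ +-monoʳ-≤ (card C) (+-monoʳ-≤ (card Sₒ) (symbols-bound {k = k} {A} Tₒ λ s q → edgeless p₀ q)) ⟩
      card C + (card Sₒ + k)        ≤⟨ room t Sₒ t∉ (λ c p → not-true (proj₂ (∧-true {S c} p)) , edgeless p q₀) p₀ ⟩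
      n                             ∎
      where
      t∉ : ∀ c → C c ≡ true → v c ≢ t
      t∉ c Cc refl = true≢false (P⁺ Cc) (not-true (proj₂ (∧-true {T (v c)} q₀)))

  open Matching (hall G not-deficient)
  prescribed : ∀ c → C c ≡ true → match c ≡ v c
  prescribed c Cc with edge c
  ... | e rewrite Cc = ⌊⌋-elim (match c F.≟ v c) e
  fresh : ∀ {i} → i < k → ∀ c → A i c ≢ match c
  fresh i<k c e with ∈-dec (C c)
  ... | inj₁ Cc = v-fresh Cc i<k (trans e (prescribed c Cc))
  ... | inj₂ ¬C with edge c
  ...   | h rewrite ¬C = absent⇒fresh {k = k} {A} (proj₂ (∧-true {not (P (match c))} h)) i<k e

-- Prescribing the cells of x and y could fail here, namely when the rows above
-- contain a latin subsquare of order k; restricting them to two windows never does.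
extend-row-windows : ∀ {k} {A : Rows n} → Rectangle k A → suc (k + k) ≤ n →
  (U W : FinSet n) → 2 ≤ card U → 1 ≤ card W → (x y : Fin n) → x ≢ y →
  (∀ {c} → U c ≡ true → present k A c x ≡ false) →
  (∀ {c} → W c ≡ true → present k A c y ≡ false) →
  (∀ t → t ≢ x → ∃[ c ] (U c ≡ true × present k A c t ≡ true)) →
  Σ (NewRow k A) λ r → ∀ c → (NewRow.row r c ≡ x → U c ≡ true) × (NewRow.row r c ≡ y → W c ≡ true)
extend-row-windows {n} {k} {A} RA k+k<n U W U≥2 W≥1 x y x≢y x-absent y-absent seen =
  newRow match injective (λ i<k c → absent⇒fresh {k = k} {A} (proj₁ (∧-true {not (present k A c (match c))} (edge c))) i<k)
  , λ c → windows c (match c) (edge c)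
  where
  in-window : Fin n → Fin n → Bool
  in-window c s = if ⌊ s F.≟ x ⌋ then U c else (if ⌊ s F.≟ y ⌋ then W c else true)
  G : Graph n
  G c s = not (present k A c s) ∧ in-window c s
  windows : ∀ c s → G c s ≡ true → (s ≡ x → U c ≡ true) × (s ≡ y → W c ≡ true)
  windows c s h with proj₂ (∧-true {not (present k A c s)} h)
  ... | w with s F.≟ x | s F.≟ y
  ...   | yes e | yes e′ = contradiction (trans (sym e) e′) x≢y
  ...   | yes e | no ne  = (λ _ → w) , λ e′ → contradiction e′ ne
  ...   | no ne | yes e  = (λ e′ → contradiction e′ ne) , λ _ → w
  ...   | no ne | no ne′ = (λ e → contradiction e ne) , λ e → contradiction e ne′
  window-x : ∀ {c} → U c ≡ true → in-window c x ≡ true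
  window-x Uc with x F.≟ x
  ... | yes _ = Uc
  ... | no ne = contradiction refl ne
  window-y : ∀ {c} → W c ≡ true → in-window c y ≡ true
  window-y Wc with y F.≟ x | y F.≟ y
  ... | yes e | _     = contradiction (sym e) x≢y
  ... | no _  | yes _ = Wc
  ... | no _  | no ne = contradiction refl ne
  window-other : ∀ {c t} → t ≢ x → t ≢ y → in-window c t ≡ true
  window-other {t = t} t≢x t≢y with t F.≟ x | t F.≟ y
  ... | yes e | _     = contradiction e t≢x
  ... | no _  | yes e = contradiction e t≢y
  ... | no _  | no _  = refl

  not-deficient : ¬ (∃₂ λ S T → Deficient G S T)
  not-deficient (S , T , deficient large no-edge) = <⇒≱ large small
    where
    open ≤-Reasoning
    T₂ : FinSet n
    T₂ = (T ∖ x) ∖ y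
    seen-in : ∀ {c t} → S c ≡ true → T t ≡ true → t ≢ x → t ≢ y → present k A c t ≡ true
    seen-in {c} {t} Sc Tt t≢x t≢y = not-false (∧-false-left (no-edge c t Sc Tt) (window-other t≢x t≢y))
    Tx⇒ : T x ≡ true → ∀ {c} → S c ≡ true → U c ≡ true → ⊥
    Tx⇒ Tx {c} Sc Uc = true≢false (∧-intro (cong not (x-absent Uc)) (window-x Uc)) (no-edge c x Sc Tx)
    Ty⇒ : T y ≡ true → ∀ {c} → S c ≡ true → W c ≡ true → ⊥
    Ty⇒ Ty {c} Sc Wc = true≢false (∧-intro (cong not (y-absent Wc)) (window-y Wc)) (no-edge c y Sc Ty)
    T₂⁻ : ∀ {t} → T₂ t ≡ true → T t ≡ true × t ≢ x × t ≢ y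
    T₂⁻ {t} p with ∧-true {(T ∖ x) t} p
    ... | q , t≢y with ∧-true {T t} q
    ...   | Tt , t≢x = Tt , ≟-false⁻ t≢x , ≟-false⁻ t≢y
    T≤T₂ : card T ≤ suc (suc (card T₂))
    T≤T₂ = ≤-trans (card-≤-suc T x) (s≤s (card-≤-suc (T ∖ x) y))
    avoid-window : (Z : FinSet n) → (∀ {c} → S c ≡ true → Z c ≡ true → ⊥) → card S + card Z ≤ n
    avoid-window Z apart = ≤-trans (+-monoˡ-≤ (card Z) (card-mono outside))
      (≤-reflexive (trans (+-comm _ (card Z)) (card-complement Z)))
      where
      outside : ∀ c → S c ≡ true → not (Z c) ≡ true
      outside c Sc with Z c in eq
      ... | false = refl
      ... | true  = ⊥-elim (apart Sc eq)
    T₂≤k : ∀ {c} → S c ≡ true → card T₂ ≤ k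
    T₂≤k {c} Sc = symbols-bound {k = k} {A} {c} T₂ λ t p → let Tt , t≢x , t≢y = T₂⁻ p in seen-in Sc Tt t≢x t≢y
    small : card S + card T ≤ n
    small with F.any? (λ t → T₂ t 𝔹.≟ true)
    ... | yes (t , p) with T₂⁻ p
    ...   | Tt , t≢x , t≢y with F.any? (λ c → (S c 𝔹.≟ true) ×-dec (U c 𝔹.≟ true))
    -- Column `c` admits `x`, so `x` is not in `T`, and `T` has at most `y` besides the symbols
    -- above `c`.
    ...     | yes (c , Sc , Uc) = begin
      card S + card T            ≤⟨ +-mono-≤ (columns-bound RA S λ c Sc → seen-in Sc Tt t≢x t≢y) T≤ ⟩
      k + suc k                  ≡⟨ +-suc k k ⟩
      suc (k + k)                ≤⟨ k+k<n ⟩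
      n                          ∎
      where
      T≤ : card T ≤ suc k
      T≤ = ≤-trans (card-mono {T = T ∖ x} λ s Ts → ∧-intro Ts (≟-false λ { refl → Tx⇒ Ts Sc Uc }))
             (≤-trans (card-≤-suc (T ∖ x) y) (s≤s (T₂≤k Sc)))
    ...     | no apart with F.any? (λ c → S c 𝔹.≟ true) | seen t t≢x
    ...       | no empty | _ = subst (λ z → z + card T ≤ n) (sym (card-⊆-empty S λ c Sc → empty (c , Sc))) (card-≤n T)
    -- Now `T` may contain both `x` and `y`, but `t` has an occurrence in the window `U`, outside
    -- `S`, and `S` shrinks by one.
    ...       | yes (c , Sc) | c₁ , Uc₁ , pr = begin
      card S + card T            ≤⟨ +-monoʳ-≤ (card S) (≤-trans T≤T₂ (s≤s (s≤s (T₂≤k Sc)))) ⟩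
      card S + suc (suc k)       ≡⟨ +-suc (card S) (suc k) ⟩
      suc (card S) + suc k       ≤⟨ +-monoˡ-≤ (suc k) (columns-bound₁ RA S (λ c Sc → seen-in Sc Tt t≢x t≢y) c₁∉ pr) ⟩
      k + suc k                  ≡⟨ +-suc k k ⟩
      suc (k + k)                ≤⟨ k+k<n ⟩
      n                          ∎
      where
      c₁∉ : S c₁ ≡ false
      c₁∉ with S c₁ in eq
      ... | false = refl
      ... | true  = ⊥-elim (apart (c₁ , eq , Uc₁))
    -- Here `T` has no symbol other than `x` and `y`. If `x` is in `T`, then `S` misses the at least
    -- two columns of `U`; if only `y` is, then `S` misses `W`.
    small | no none with ∈-dec (T x)
    ... | inj₁ Tx = begin
      card S + card T            ≤⟨ +-monoʳ-≤ (card S) (subst (λ z → card T ≤ suc (suc z)) T₂≡0 T≤T₂) ⟩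
      card S + 2                 ≤⟨ +-monoʳ-≤ (card S) U≥2 ⟩
      card S + card U            ≤⟨ avoid-window U (Tx⇒ Tx) ⟩
      n                          ∎
      where
      T₂≡0 : card T₂ ≡ 0
      T₂≡0 = card-⊆-empty T₂ λ t p → none (t , p)
    ... | inj₂ ¬Tx with ∈-dec (T y)
    ...   | inj₁ Ty = begin
      card S + card T            ≤⟨ +-monoʳ-≤ (card S) T≤1 ⟩
      card S + 1                 ≤⟨ +-monoʳ-≤ (card S) W≥1 ⟩
      card S + card W            ≤⟨ avoid-window W (Ty⇒ Ty) ⟩
      n                          ∎
      where
      T≤1 : card T ≤ 1
      T≤1 = ≤-trans (card-mono {T = T ∖ x} λ s Ts → ∧-intro Ts (≟-false λ { refl → true≢false Ts ¬Tx }))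
              (≤-trans (card-≤-suc (T ∖ x) y) (s≤s (≤-reflexive (card-⊆-empty T₂ λ t p → none (t , p)))))
    ...   | inj₂ ¬Ty = subst (λ z → card S + z ≤ n) (sym (card-⊆-empty T empty))
                         (subst (_≤ n) (sym (+-identityʳ (card S))) (card-≤n S))
      where
      empty : ∀ t → T t ≡ true → ⊥
      empty t Tt = none (t , ∧-intro (∧-intro Tt (≟-false λ { refl → true≢false Tt ¬Tx })) (≟-false λ { refl → true≢false Tt ¬Ty }))

  open Matching (hall G not-deficient)

-- Completing the array

module Window {n : ℕ} (slot : Fin n → ℕ)
  (slot-injective : ∀ {c c′} → slot c ≡ slot c′ → c ≡ c′)
  (column : ∀ {σ} → σ < n → ∃[ c ] slot c ≡ σ) where

  window : ℕ → FinSet n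
  window w c = ⌊ slot c <? w ⌋

  window⁻ : ∀ {w c} → window w c ≡ true → slot c < w
  window⁻ {w} {c} = ⌊⌋-elim (slot c <? w)

  window⁺ : ∀ {w c} → slot c < w → window w c ≡ true
  window⁺ {w} {c} = ⌊⌋-intro (slot c <? w)

  card-window-≤ : ∀ w → card (window w) ≤ w
  card-window-≤ w = subst (card (window w) ≤_) card-full
    (card-injection (window w) (λ (_ : Fin w) → true) (λ c p → fromℕ< (window⁻ p)) (λ _ _ → refl)
      λ c c′ p p′ e → slot-injective (F.fromℕ<-injective _ _ (window⁻ p) (window⁻ p′) e))

  card-window-≥ : ∀ {w} → w ≤ n → w ≤ card (window w)
  card-window-≥ {w} w≤n = subst (_≤ card (window w)) card-full
    (card-injection (λ (_ : Fin w) → true) (window w) (λ i _ → proj₁ (col i))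
      (λ i _ → window⁺ (subst (_< w) (sym (proj₂ (col i))) (F.toℕ<n i)))
      λ i j _ _ e → F.toℕ-injective (trans (sym (proj₂ (col i))) (trans (cong slot e) (proj₂ (col j)))))
    where
    col : (i : Fin w) → ∃[ c ] slot c ≡ toℕ i
    col i = column (≤-trans (F.toℕ<n i) w≤n)

toℕ-column : ∀ {n σ} → σ < n → ∃[ c ] toℕ {n} c ≡ σ
toℕ-column σ<n = fromℕ< σ<n , F.toℕ-fromℕ< σ<n

opposite-injective : ∀ {n} {c c′ : Fin n} → toℕ (opposite c) ≡ toℕ (opposite c′) → c ≡ c′
opposite-injective {c = c} {c′} e = trans (sym (F.opposite-involutive c))
  (trans (cong opposite (F.toℕ-injective e)) (F.opposite-involutive c′))

opposite-column : ∀ {n σ} → σ < n → ∃[ c ] toℕ {n} (opposite c) ≡ σ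
opposite-column σ<n = opposite (fromℕ< σ<n) , trans (cong toℕ (F.opposite-involutive (fromℕ< σ<n))) (F.toℕ-fromℕ< σ<n)

opposite-sum : ∀ {n} (c : Fin n) → suc (toℕ c + toℕ (opposite c)) ≡ n
opposite-sum {n} c = trans (cong (λ z → suc (toℕ c + z)) (F.opposite-prop c)) (m+[n∸m]≡n (F.toℕ<n c))

-- The array has order n = 2 (k + 1) + ε. The rows 0 , … , k are prescribed by the
-- tables at time k + ε; for odd n the last table row constrains row k + 1 of the array.
module Completion (n k ε : ℕ) (4≤k : 4 ≤ k) (ε≤1 : ε ≤ 1) (n≡ : n ≡ suc k + suc k + ε) where

  open Tables n

  K : ℕ
  K = k + ε

  k≤K : k ≤ K
  k≤K = m≤m+n k ε

  K≤1+k : K ≤ suc k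
  K≤1+k = subst (K ≤_) (+-comm k 1) (+-monoʳ-≤ k ε≤1)

  1≤k : 1 ≤ k
  1≤k = ≤-trans (s≤s z≤n) 4≤k

  -- Numerical bounds

  private
    by : ∀ a {b} d → b ≡ a + d → a ≤ b
    by a d e = subst (a ≤_) (sym e) (m≤m+n a d)

    k≡ : ∃[ j ] 4 + j ≡ k
    k≡ = k ∸ 4 , m+[n∸m]≡n 4≤k

  10≤n : 10 ≤ n
  10≤n with j , refl ← k≡ = by 10 (j + j + ε) (trans n≡
    (solve 2 (λ j ε → con 5 :+ j :+ (con 5 :+ j) :+ ε := con 10 :+ (j :+ j :+ ε)) refl j ε))
    where open +-*-Solver

  2≤width : 2 ≤ n / suc k
  2≤width = subst (_≤ n / suc k) (m*n/n≡m 2 (suc k)) (/-monoˡ-≤ (suc k) (by (2 * suc k) ε (trans n≡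
    (solve 2 (λ k ε → con 1 :+ k :+ (con 1 :+ k) :+ ε := con 2 :* (con 1 :+ k) :+ ε) refl k ε))))
    where open +-*-Solver

  width≤2 : n / suc k ≤ 2
  width≤2 = ≤-pred (m<n*o⇒m/o<n {n} {3} {suc k} lt)
    where
    lt : n < 3 * suc k
    lt = ≤-trans (s≤s (subst (_≤ suc k + suc k + 1) (sym n≡) (+-monoʳ-≤ (suc k + suc k) ε≤1))) go
      where
      open +-*-Solver
      go : suc (suc k + suc k + 1) ≤ 3 * suc k
      go with j , refl ← k≡ = by (suc (5 + j + (5 + j) + 1)) (3 + j)
        (solve 1 (λ j → con 3 :* (con 5 :+ j) := con 1 :+ (con 5 :+ j :+ (con 5 :+ j) :+ con 1) :+ (con 3 :+ j)) refl j)

  -- At time `K` all alive cells are in the two outermost columns, so a single time covers every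
  -- later rectangle that has two columns.
  size-K≤2 : ∀ i → size i K ≤ 2
  size-K≤2 i = ≤-trans (size-≤-ceil i K) (≤-pred (m<n*o⇒m/o<n {n + K} {3} {suc K} (by (suc (n + K)) ε (trans
    (solve 2 (λ k ε → con 3 :* (con 1 :+ (k :+ ε)) := con 1 :+ ((con 1 :+ k :+ (con 1 :+ k) :+ ε) :+ (k :+ ε)) :+ ε) refl k ε)
    (cong (λ z → suc (z + K) + ε) (sym n≡))))))
    where open +-*-Solver

  2≤ceil : ∀ {j} → suc j < n → 2 ≤ ⌈ n /suc j ⌉
  2≤ceil {j} lt = subst (_≤ ⌈ n /suc j ⌉) (m*n/n≡m 2 (suc j)) (/-monoˡ-≤ (suc j)
    (≤-trans (≤-reflexive (solve 1 (λ j → con 2 :* (con 1 :+ j) := (con 2 :+ j) :+ j) refl j)) (+-monoˡ-≤ j lt)))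
    where open +-*-Solver

  1≤ceil : ∀ {j} → j < n → 1 ≤ ⌈ n /suc j ⌉
  1≤ceil {j} lt = subst (_≤ ⌈ n /suc j ⌉) (n/n≡1 (suc j)) (/-monoˡ-≤ (suc j) (≤-trans lt (m≤m+n n j)))

  n/2≡ : n / 2 ≡ suc k
  n/2≡ = ≤-antisym
    (≤-pred (m<n*o⇒m/o<n {n} {suc (suc k)} {2} (≤-trans (s≤s (subst (_≤ suc k + suc k + 1) (sym n≡) (+-monoʳ-≤ (suc k + suc k) ε≤1)))
      (≤-reflexive (solve 1 (λ k → con 1 :+ (con 1 :+ k :+ (con 1 :+ k) :+ con 1) := (con 2 :+ k) :* con 2) refl k)))))
    (subst (_≤ n / 2) (m*n/n≡m (suc k) 2) (/-monoˡ-≤ 2 (by (suc k * 2) ε (trans n≡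
      (solve 2 (λ k ε → con 1 :+ k :+ (con 1 :+ k) :+ ε := (con 1 :+ k) :* con 2 :+ ε) refl k ε)))))
    where open +-*-Solver

  -- This makes the innermost cell of row 0 die at time 2, as the treatment of the middle column
  -- requires.
  shrinks : size 0 2 < half
  shrinks = ≤-trans (s≤s (size-≤-ceil 0 2)) (≤-trans (m<n*o⇒m/o<n {n + 2} {suc k} {3} lt)
    (≤-trans (≤-reflexive (sym n/2≡)) (quotient-≤-size 0 1)))
    where
    open +-*-Solver
    lt : n + 2 < suc k * 3
    lt = ≤-trans (s≤s (+-monoˡ-≤ 2 (subst (_≤ suc k + suc k + 1) (sym n≡) (+-monoʳ-≤ (suc k + suc k) ε≤1)))) go
      where
      go : suc ((suc k + suc k + 1) + 2) ≤ suc k * 3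
      go with j , refl ← k≡ = by (suc ((5 + j + (5 + j) + 1) + 2)) (1 + j)
        (solve 1 (λ j → (con 5 :+ j) :* con 3 := con 1 :+ ((con 5 :+ j :+ (con 5 :+ j) :+ con 1) :+ con 2) :+ (con 1 :+ j)) refl j)

  -- The difference of `a * suc κ` and the left side is `(a - 2) * (κ - 1) - 2`, which is negative
  -- only for `a ≤ 2` and for `a = 3`, `κ = 2`. In the former case `κ < k` gives `4 + 2κ ≤ n`; the
  -- latter needs `10 ≤ n`.
  prescribed-bound : ∀ {κ} → 2 ≤ κ → κ < k → ∀ {a} → a * suc κ ≤ n → (a + a) + (κ + κ) ≤ n
  prescribed-bound {suc (suc j)} (s≤s (s≤s z≤n)) κ<k {a} le = go a le
    where
    open +-*-Solver
    κ = suc (suc j)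
    few : 4 + (κ + κ) ≤ n
    few = ≤-trans (≤-reflexive (solve 1 (λ j → con 4 :+ ((con 2 :+ j) :+ (con 2 :+ j)) := (con 4 :+ j) :+ (con 4 :+ j)) refl j))
      (≤-trans (+-mono-≤ (s≤s κ<k) (s≤s κ<k)) (by (suc k + suc k) ε n≡))
    three : ∀ j → 3 * (3 + j) ≤ n → 6 + ((2 + j) + (2 + j)) ≤ n
    three zero    _ = 10≤n
    three (suc j) h = ≤-trans (by (6 + ((3 + j) + (3 + j))) j
      (solve 1 (λ j → con 3 :* (con 4 :+ j) := con 6 :+ ((con 3 :+ j) :+ (con 3 :+ j)) :+ j) refl j)) h
    go : ∀ a → a * suc κ ≤ n → (a + a) + (κ + κ) ≤ n
    go 0 _ = ≤-trans (m≤n+m (κ + κ) 4) few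
    go 1 _ = ≤-trans (+-monoˡ-≤ (κ + κ) {2} {4} (s≤s (s≤s z≤n))) few
    go 2 _ = few
    go 3 h = three j h
    go (suc (suc (suc (suc b)))) h = ≤-trans (by (((4 + b) + (4 + b)) + (κ + κ)) (j + j + b + b * j)
      (solve 2 (λ b j → (con 4 :+ b) :* (con 3 :+ j) := (((con 4 :+ b) :+ (con 4 :+ b)) :+ ((con 2 :+ j) :+ (con 2 :+ j))) :+ (j :+ j :+ b :+ b :* j)) refl b j)) h

  width-antitone : ∀ {i j} → i ≤ j → width j ≤ width i
  width-antitone {j = zero}  z≤n = ≤-refl
  width-antitone {zero} {suc j} _ = ≤-trans (/-monoʳ-≤ n (s≤s (s≤s z≤n))) (quotient-≤-size 0 1)
  width-antitone {suc i} {suc j} (s≤s le) = /-monoʳ-≤ n (s≤s (s≤s le))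

  2≤width-≤k : ∀ {i} → i ≤ k → 2 ≤ width i
  2≤width-≤k {i} i≤k = ≤-trans (width-k k refl) (width-antitone i≤k)
    where
    width-k : ∀ j → j ≡ k → 2 ≤ width k
    width-k zero    e = contradiction (subst (4 ≤_) (sym e) 4≤k) λ ()
    width-k (suc j) refl = 2≤width

  2≤K : 2 ≤ K
  2≤K = ≤-trans (≤-trans (s≤s (s≤s z≤n)) 4≤k) k≤K

  width-≡ : ∀ {i} → 1 ≤ i → width i ≡ n / suc i
  width-≡ (s≤s z≤n) = refl

  private
    n≡-odd : K ≡ suc k → n ≡ K + 1 * suc K
    n≡-odd K≡ = begin
      n                       ≡⟨ n≡ ⟩
      suc k + suc k + ε       ≡⟨ solve 2 (λ k ε → con 1 :+ k :+ (con 1 :+ k) :+ ε := (con 1 :+ k) :+ (con 1 :+ (k :+ ε))) refl k ε ⟩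
      suc k + suc K           ≡⟨ cong₂ _+_ (sym K≡) (sym (*-identityˡ (suc K))) ⟩
      K + 1 * suc K           ∎
      where open ≡-Reasoning
            open +-*-Solver

  -- For odd `n` one has `n = K + (K + 1)`: at time `K` each row but the last holds two symbols, and
  -- the last one holds a single symbol.
  2≤size-last : K ≡ suc k → ∀ {i} → i < K → 2 ≤ size i K
  2≤size-last K≡ {i} i<K = +-mono-≤
    (subst (_≤ n / suc K) (n/n≡1 (suc K)) (/-monoˡ-≤ (suc K)
      (subst (suc K ≤_) (sym (n≡-odd K≡)) (≤-trans (≤-reflexive (sym (*-identityˡ (suc K)))) (m≤n+m _ K)))))
    (≤-reflexive (sym (extra-< (subst (i <_) (sym remainder) i<K))))
    where
    remainder : n % suc K ≡ K
    remainder = trans (cong (_% suc K) (n≡-odd K≡)) (trans ([m+kn]%n≡m%n K 1 (suc K)) (m<n⇒m%n≡m ≤-refl))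

  width-last : K ≡ suc k → width K ≡ 1
  width-last K≡ = trans (width-≡ (<⇒≤ 2≤K)) (≤-antisym
    (≤-pred (m<n*o⇒m/o<n {n} {2} {suc K} (≤-reflexive (trans (cong suc (n≡-odd K≡))
      (solve 1 (λ K → con 1 :+ (K :+ con 1 :* (con 1 :+ K)) := con 2 :* (con 1 :+ K)) refl K)))))
    (subst (_≤ n / suc K) (n/n≡1 (suc K)) (/-monoˡ-≤ (suc K)
      (subst (suc K ≤_) (sym (n≡-odd K≡)) (≤-trans (≤-reflexive (sym (*-identityˡ (suc K)))) (m≤n+m _ K))))))
    where open +-*-Solver

  -- One end of the array; slots are counted from that end.
  module End
    (D : Table) (SD : Side K D)
    (slot : Fin n → ℕ)
    (slot-injective : ∀ {c c′} → slot c ≡ slot c′ → c ≡ c′)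
    (column : ∀ {σ} → σ < n → ∃[ c ] slot c ≡ σ)
    (slot< : ∀ c → slot c < n)
    -- Row `i` of the array is filled from row `ρ i` of the table: `ρ` is the identity on the left
    -- and `swap₀₁` on the right.
    (ρ : ℕ → ℕ) (ρ-involutive : ∀ i → ρ (ρ i) ≡ i)
    (ρ-≤ : ∀ {i j} → 1 ≤ j → i ≤ j → ρ i ≤ j)
    (ρ-fixes : ∀ {i} → 2 ≤ i → ρ i ≡ i)
    where

    open Side SD public
    open Window slot slot-injective column public

    Agrees : ℕ → Rows n → Set
    Agrees κ A = ∀ {i} → i < κ → ∀ {c s} → At (D (ρ i)) (slot c) s → A i c ≡ s

    ρ-injective : ∀ {i j} → ρ i ≡ ρ j → i ≡ j
    ρ-injective {i} {j} e = trans (sym (ρ-involutive i)) (trans (cong ρ e) (ρ-involutive j))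

    ρ-≤K : ∀ {i} → i ≤ K → ρ i ≤ K
    ρ-≤K = ρ-≤ (≤-trans 1≤k k≤K)

    width≤n : ∀ {i} → i ≤ K → width i ≤ n
    width≤n {i} i≤ = ≤-trans (width-antitone {0} {i} z≤n) (subst (half ≤_) half+half (m≤m+n half (n / 2)))

    At⇒column : ∀ {i σ s} → i ≤ K → At (D (ρ i)) σ s → ∃[ c ] (slot c ≡ σ × At (D (ρ i)) (slot c) s)
    At⇒column {i} {σ} {s} i≤ p with c , e ← column (≤-trans (subst (σ <_) (row-length (ρ-≤K i≤)) (At-< p)) (width≤n (ρ-≤K i≤))) =
      c , e , subst (λ τ → At (D (ρ i)) τ s) (sym e) p

    ∈⇒column : ∀ {i s} → i ≤ K → s ∈ D (ρ i) → ∃[ c ] At (D (ρ i)) (slot c) s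
    ∈⇒column i≤ p with σ , q ← ∈⇒At p with c , _ , r ← At⇒column i≤ q = c , r

    entry : ∀ {κ A} → Agrees κ A → ∀ {i} → i < κ → i ≤ K → ∀ {c s} → slot c < width (ρ i) → A i c ≡ s →
            At (D (ρ i)) (slot c) s
    entry ag {i} i<κ i≤K {c} lt e with s′ , p ← At-total (D (ρ i)) (slot c) (subst (slot c <_) (sym (row-length (ρ-≤K i≤K))) lt) =
      subst (At (D (ρ i)) (slot c)) (trans (sym (ag i<κ p)) e) p

    fresh : ∀ {κ A} → Agrees κ A → κ ≤ K → ∀ {c s} → At (D (ρ κ)) (slot c) s →
            ∀ {i} → i < κ → slot c < width (ρ i) → A i c ≢ s
    fresh ag κ≤K p i<κ lt e =
      <⇒≢ i<κ (ρ-injective (col-unique (ρ-≤K i≤K) (ρ-≤K κ≤K) (entry ag i<κ i≤K lt e) p))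
      where i≤K = ≤-trans (<⇒≤ i<κ) κ≤K

    -- At time `K` the symbol is alive in some table row, within the first two slots. Either that
    -- row has already been written to the array, or it is still to come.
    locate : ∀ {κ A} → Agrees κ A → ∀ t →
      (∃[ i ] ∃[ c ] (i < κ × i ≤ K × slot c < 2 × A i c ≡ t)) ⊎ (∃[ i ] (κ ≤ i × i ≤ K × t ∈ D (ρ i)))
    locate {κ} ag t with i′ , σ , i′≤K , σ< , p ← cover (≤-trans 1≤k k≤K) ≤-refl t with ρ i′ <? κ
    ... | no ¬lt = inj₂ (ρ i′ , ≮⇒≥ ¬lt , ρ-≤K i′≤K , subst (λ j → t ∈ D j) (sym (ρ-involutive i′)) (At⇒∈ p))
    ... | yes lt with c , e , q ← At⇒column (ρ-≤K i′≤K) (subst (λ j → At (D j) σ t) (sym (ρ-involutive i′)) p) =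
      inj₁ (ρ i′ , c , lt , ρ-≤K i′≤K , subst (_< 2) (sym e) (≤-trans σ< (size-K≤2 i′)) , ag lt q)

    -- The first rectangle is a full row and the last contains a full column. Up to row `k` the
    -- table covers at the matching time; in between, the rectangles have at least two columns and
    -- contain everything alive at time `K`.
    covered : ∀ {A} → Rectangle n A → Agrees (suc k) A →
      (∀ {i s} → suc k ≤ i → i ≤ K → s ∈ D (ρ i) → ∃[ c ] (slot c < 2 × A i c ≡ s)) →
      ∀ j → j < n → ∀ s → ∃[ i ] ∃[ c ] (i ≤ j × slot c < ⌈ n /suc j ⌉ × A i c ≡ s)
    covered {A} RA ag last zero 0<n s with c , e ← injective⇒surjective (A 0) (Rectangle.row-injective RA 0<n) s =
      0 , c , z≤n , ≤-trans (slot< c) (≤-reflexive (trans (sym (n/1≡n n)) (cong (_/ 1) (sym (+-identityʳ n))))) , e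
    covered {A} RA ag last (suc j) j<n s with suc j ≤? k
    ... | yes j≤k with i′ , σ , i′≤j , σ< , p ← cover {suc j} (s≤s z≤n) (≤-trans j≤k k≤K) s
      with c , e , q ← At⇒column {ρ i′} (ρ-≤K (≤-trans i′≤j (≤-trans j≤k k≤K))) (subst (λ l → At (D l) σ s) (sym (ρ-involutive i′)) p)
      = ρ i′ , c , ρ-≤ (s≤s z≤n) i′≤j , subst (_< ⌈ n /suc suc j ⌉) (sym e) (≤-trans σ< (size-≤-ceil i′ (suc j)))
        , ag (s≤s (≤-trans (ρ-≤ (s≤s z≤n) i′≤j) j≤k)) q
    ... | no ¬j≤k with m≤n⇒m<n∨m≡n j<n
    ...   | inj₂ last-row with c , e ← column {0} (≤-trans (s≤s z≤n) 10≤n)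
      with r , f ← injective⇒surjective (λ r → A (toℕ r) c) (λ {r} {r′} h → F.toℕ-injective
                     (Rectangle.col-injective RA (F.toℕ<n r) (F.toℕ<n r′) h)) s
      = toℕ r , c , ≤-pred (subst (toℕ r <_) (sym last-row) (F.toℕ<n r)) , subst (_< ⌈ n /suc suc j ⌉) (sym e) (1≤ceil j<n) , f
    covered {A} RA ag last (suc j) j<n s | no ¬j≤k | inj₁ lt with locate {suc k} ag s
    ... | inj₁ (i , c , s≤s i≤k , _ , c< , e) = i , c , ≤-trans i≤k (<⇒≤ (≰⇒> ¬j≤k)) , ≤-trans c< (2≤ceil lt) , e
    ... | inj₂ (i , k<i , i≤K , s∈) with c , c< , e ← last k<i i≤K s∈ =
      i , c , ≤-trans i≤K (≤-trans K≤1+k (≰⇒> ¬j≤k)) , ≤-trans c< (2≤ceil lt) , e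

    -- In the rows before row `K` the two outermost cells are alive at time `K`, and `x` is already
    -- alive in row `K`.
    absent-last : ∀ {A} → Agrees (suc k) A → K ≡ suc k → ∀ {x} → x ∈ D (ρ K) →
      ∀ {c} → window 2 c ≡ true → present (suc k) A c x ≡ false
    absent-last {A} ag K≡ {x} x∈ {c} w with ∈-dec (present (suc k) A c x)
    ... | inj₂ f = f
    ... | inj₁ pr with i , e ← present⁻ {k = suc k} {A} pr | τ , q ← ∈⇒At x∈ = contradiction
      (ρ-injective (alive-unique (ρ-≤K i≤K) (ρ-≤K ≤-refl)
        (≤-trans (window⁻ {2} w) (2≤size-last K≡ (ρ-< i<K)))
        (≤-trans (subst (τ <_) (trans (row-length (ρ-≤K ≤-refl)) (trans (cong width (ρ-fixes 2≤K)) (width-≡ (<⇒≤ 2≤K)))) (At-< q)) (quotient-≤-size _ K))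
        (entry ag (F.toℕ<n i) i≤K (≤-trans (window⁻ {2} w) (2≤width-≤k (ρ-≤ 1≤k (≤-pred (F.toℕ<n i))))) e) q))
      (<⇒≢ i<K)
      where
      i<K : toℕ i < K
      i<K = subst (toℕ i <_) (sym K≡) (F.toℕ<n i)
      i≤K : toℕ i ≤ K
      i≤K = <⇒≤ i<K
      ρ-< : ∀ {i} → i < K → ρ i < K
      ρ-< {i} i<K = subst (ρ i <_) (sym K≡) (s≤s (ρ-≤ 1≤k (≤-pred (subst (i <_) K≡ i<K))))

    last-entry : K ≡ suc k → ∃[ x ] (x ∈ D (ρ K) × (∀ {t} → t ∈ D (ρ K) → t ≡ x))
    last-entry K≡ with D (ρ K) | trans (row-length (ρ-≤K ≤-refl)) (trans (cong width (ρ-fixes 2≤K)) (width-last K≡))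
    ... | x ∷ [] | refl = x , here refl , λ { (here e) → e }

    seen-before-last : ∀ {A} → Agrees (suc k) A → K ≡ suc k → ∀ {t} → t ∉ D (ρ K) →
      ∃[ c ] (window 2 c ≡ true × present (suc k) A c t ≡ true)
    seen-before-last {A} ag K≡ {t} t∉ with locate {suc k} ag t
    ... | inj₁ (i , c , i< , _ , c< , e) = c , window⁺ c< , present⁺ {k = suc k} {A} i< e
    ... | inj₂ (i , k<i , i≤K , t∈) =
      contradiction (subst (λ j → t ∈ D (ρ j)) (≤-antisym i≤K (subst (_≤ i) (sym K≡) k<i)) t∈) t∉

  -- Filling the first half of the rows

  module Assembly (T : Tables₂ K) where
    open Tables₂ T
    module L = End left left-side toℕ F.toℕ-injective toℕ-column F.toℕ<n id (λ _ → refl) (λ _ h → h) (λ _ → refl)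
    module R = End right right-side (toℕ ∘ opposite) opposite-injective opposite-column (F.toℕ<n ∘ opposite)
                 swap₀₁ swap₀₁-involutive swap₀₁-≤ swap₀₁-fixes

    module Row {κ : ℕ} (κ≤k : κ ≤ k) {A : Rows n} (RA : Rectangle κ A)
               (agL : L.Agrees κ A) (agR : R.Agrees κ A) where

      κ≤K : κ ≤ K
      κ≤K = ≤-trans κ≤k k≤K

      Prescribed : Fin n → Fin n → Set
      Prescribed c s = At (left κ) (toℕ c) s ⊎ At (right (swap₀₁ κ)) (toℕ (opposite c)) s

      left-length : length (left κ) ≡ width κ
      left-length = L.row-length κ≤K

      right-length : length (right (swap₀₁ κ)) ≡ width (swap₀₁ κ)
      right-length = R.row-length (R.ρ-≤K κ≤K)

      prescribed? : ∀ c → Dec (∃[ s ] Prescribed c s)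
      prescribed? c with toℕ c <? length (left κ)
      ... | yes lt with s , p ← At-total (left κ) (toℕ c) lt = yes (s , inj₁ p)
      ... | no ¬l with toℕ (opposite c) <? length (right (swap₀₁ κ))
      ...   | yes lt with s , p ← At-total (right (swap₀₁ κ)) (toℕ (opposite c)) lt = yes (s , inj₂ p)
      ...   | no ¬r = no λ { (s , inj₁ p) → ¬l (At-< p) ; (s , inj₂ p) → ¬r (At-< p) }

      C : FinSet n
      C c = ⌊ prescribed? c ⌋

      v : Fin n → Fin n
      v c with prescribed? c
      ... | yes (s , _) = s
      -- A default value; `v` is read only where `C` holds.
      ... | no _        = c

      v-prescribed : ∀ {c} → C c ≡ true → Prescribed c (v c)
      v-prescribed {c} h with prescribed? c
      ... | yes (_ , p) = p
      v-prescribed () | no _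

      widths≤n : ∀ κ → width κ + width (swap₀₁ κ) ≤ n
      widths≤n zero          = ≤-reflexive half+half
      widths≤n (suc zero)    = ≤-reflexive (trans (+-comm _ half) half+half)
      widths≤n (suc (suc κ)) = ≤-trans (+-mono-≤ (width-antitone {1} {suc (suc κ)} (s≤s z≤n)) (width-antitone {1} {suc (suc κ)} (s≤s z≤n)))
        (≤-trans (+-monoˡ-≤ (n / 2) (quotient-≤-size 0 1)) (≤-reflexive half+half))

      no-overlap : ∀ {c} → toℕ c < width κ → toℕ (opposite c) < width (swap₀₁ κ) → ⊥
      no-overlap {c} l r = contradiction (≤-trans (+-mono-≤ l r) (widths≤n κ))
        (<⇒≱ (≤-reflexive (trans (cong suc (sym (opposite-sum c))) (cong suc (sym (+-suc (toℕ c) (toℕ (opposite c))))))))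

      functional : ∀ {c s s′} → Prescribed c s → Prescribed c s′ → s ≡ s′
      functional (inj₁ p) (inj₁ q) = At-functional p q
      functional (inj₂ p) (inj₂ q) = At-functional p q
      functional (inj₁ p) (inj₂ q) = ⊥-elim (no-overlap (subst (_ <_) left-length (At-< p)) (subst (_ <_) right-length (At-< q)))
      functional (inj₂ p) (inj₁ q) = ⊥-elim (no-overlap (subst (_ <_) left-length (At-< q)) (subst (_ <_) right-length (At-< p)))

      prescribed⇒ : ∀ {c s} → Prescribed c s → C c ≡ true × v c ≡ s
      prescribed⇒ {c} {s} p = Cc , functional (v-prescribed Cc) p
        where
        Cc : C c ≡ true
        Cc = ⌊⌋-intro (prescribed? c) (s , p)

      injective : ∀ {c c′ s} → Prescribed c s → Prescribed c′ s → c ≡ c′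
      injective (inj₁ p) (inj₁ q) = F.toℕ-injective (At-injective (L.row-unique κ≤K) p q)
      injective (inj₂ p) (inj₂ q) = opposite-injective (At-injective (R.row-unique (R.ρ-≤K κ≤K)) p q)
      injective (inj₁ p) (inj₂ q) = ⊥-elim (disjoint κ≤K (At⇒∈ p) (At⇒∈ q))
      injective (inj₂ p) (inj₁ q) = ⊥-elim (disjoint κ≤K (At⇒∈ q) (At⇒∈ p))

      v-injective : ∀ {c c′} → C c ≡ true → C c′ ≡ true → v c ≡ v c′ → c ≡ c′
      v-injective {c} {c′} h h′ e = injective (v-prescribed h) (subst (Prescribed c′) (sym e) (v-prescribed h′))

      left-fresh : ∀ {c s} → At (left κ) (toℕ c) s → ∀ {i} → i < κ → A i c ≢ s
      left-fresh p i<κ = L.fresh agL κ≤K p i<κ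
        (≤-trans (subst (_ <_) left-length (At-< p)) (width-antitone (<⇒≤ i<κ)))

      right-fresh : ∀ {c s} → At (right (swap₀₁ κ)) (toℕ (opposite c)) s → ∀ {i} → i < κ →
        toℕ (opposite c) < width (swap₀₁ i) → A i c ≢ s
      right-fresh p i<κ = R.fresh agR κ≤K p i<κ

      fresh : ∀ {c} → C c ≡ true → ∀ {i} → i < κ → A i c ≢ v c
      fresh {c} Cc {i} i<κ with v-prescribed Cc
      ... | inj₁ p = left-fresh p i<κ
      ... | inj₂ p with toℕ (opposite c) <? width (swap₀₁ i)
      ...   | yes lt = right-fresh p i<κ lt
      ...   | no ¬lt = λ e → corner κ i i<κ p (≮⇒≥ ¬lt) (subst (_ <_) right-length (At-< p))
                         (λ lt → L.entry agL i<κ (≤-trans (<⇒≤ i<κ) κ≤K) lt e)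
        where
        -- Only the middle column of an odd array, in the second row, is special.
        corner : ∀ κ i → i < κ → At (right (swap₀₁ κ)) (toℕ (opposite c)) (v c) →
          width (swap₀₁ i) ≤ toℕ (opposite c) → toℕ (opposite c) < width (swap₀₁ κ) →
          (toℕ c < width i → At (left i) (toℕ c) (v c)) → ⊥
        corner (suc (suc κ)) i i<κ _ ge lt _ =
          <⇒≱ lt (≤-trans (width-antitone (swap₀₁-≤ (s≤s z≤n) (<⇒≤ i<κ))) ge)
        corner (suc zero) (suc i) (s≤s ())
        corner (suc zero) zero _ p ge lt q = middle 2≤K
          (subst (λ σ → At (left 0) σ (v c)) c≡ (q (subst (_< half) (sym c≡) (∸1< half lt))))
          (subst (λ σ → At (right 0) σ (v c)) opp≡ p)
          where
          ∸1< : ∀ h {m} → m < h → h ∸ 1 < h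
          ∸1< (suc h) _ = ≤-refl
          half≤ : half ≤ suc (n / 2)
          half≤ = subst (half ≤_) (+-comm (n / 2) 1) (+-monoʳ-≤ (n / 2) (extra-≤1 0 (n % 2)))
          half≡ : half ≡ suc (n / 2)
          half≡ = ≤-antisym half≤ (≤-trans (s≤s ge) lt)
          opp≡n/2 : toℕ (opposite c) ≡ n / 2
          opp≡n/2 = ≤-antisym (≤-pred (≤-trans lt half≤)) ge
          opp≡ : toℕ (opposite c) ≡ half ∸ 1
          opp≡ = trans opp≡n/2 (sym (cong (_∸ 1) half≡))
          c≡ : toℕ c ≡ half ∸ 1
          c≡ = +-cancelʳ-≡ (n / 2) (toℕ c) (half ∸ 1) (suc-injective (begin
            suc (toℕ c + n / 2)             ≡⟨ cong (λ z → suc (toℕ c + z)) (sym opp≡n/2) ⟩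
            suc (toℕ c + toℕ (opposite c))  ≡⟨ opposite-sum c ⟩
            n                               ≡⟨ sym half+half ⟩
            half + n / 2                    ≡⟨ cong (_+ n / 2) (trans half≡ (cong suc (sym (cong (_∸ 1) half≡)))) ⟩
            suc (half ∸ 1 + n / 2)          ∎))
            where open ≡-Reasoning

      left-column : ∀ {c} → toℕ c < width κ → C c ≡ true
      left-column {c} lt = proj₁ (prescribed⇒ (inj₁ (proj₂ (At-total (left κ) (toℕ c) (subst (toℕ c <_) (sym left-length) lt)))))

      right-column : ∀ {c} → toℕ (opposite c) < width (swap₀₁ κ) → C c ≡ true
      right-column {c} lt = proj₁ (prescribed⇒ (inj₂ (proj₂
        (At-total (right (swap₀₁ κ)) (toℕ (opposite c)) (subst (toℕ (opposite c) <_) (sym right-length) lt)))))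

      full : width κ + width (swap₀₁ κ) ≡ n → ∀ c → C c ≡ true
      full e c with toℕ c <? width κ | toℕ (opposite c) <? width (swap₀₁ κ)
      ... | yes lt | _      = left-column lt
      ... | no _   | yes lt = right-column lt
      ... | no ¬l  | no ¬r  = contradiction (+-mono-≤ (≮⇒≥ ¬l) (≮⇒≥ ¬r))
            (<⇒≱ (≤-reflexive (trans (opposite-sum c) (sym e))))

      card-C : card C ≤ width κ + width (swap₀₁ κ)
      card-C = begin
        card C                                            ≤⟨ card-mono in-windows ⟩
        card (λ c → Wl c ∨ Wr c)                          ≤⟨ m≤m+n _ (card (λ c → Wl c ∧ Wr c)) ⟩
        card (λ c → Wl c ∨ Wr c) + card (λ c → Wl c ∧ Wr c) ≡⟨ card-∨-∧ Wl Wr ⟩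
        card Wl + card Wr                                 ≤⟨ +-mono-≤ (L.card-window-≤ (width κ)) (R.card-window-≤ (width (swap₀₁ κ))) ⟩
        width κ + width (swap₀₁ κ)                        ∎
        where
        open ≤-Reasoning
        Wl Wr : FinSet n
        Wl = L.window (width κ)
        Wr = R.window (width (swap₀₁ κ))
        in-windows : ∀ c → C c ≡ true → Wl c ∨ Wr c ≡ true
        in-windows c Cc with v-prescribed Cc
        ... | inj₁ p = cong (_∨ Wr c) (L.window⁺ {width κ} {c} (subst (toℕ c <_) left-length (At-< p)))
        ... | inj₂ p = trans (cong (Wl c ∨_) (R.window⁺ {width (swap₀₁ κ)} {c} (subst (toℕ (opposite c) <_) right-length (At-< p))))
                         (𝔹.∨-zeroʳ (Wl c))

      module Room (t : Fin n) (S : FinSet n) (t∉ : ∀ c → C c ≡ true → v c ≢ t)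
                  (S-free : ∀ c → S c ≡ true → C c ≡ false × present κ A c t ≡ true) where

        unprescribed : ∀ {c} → ¬ Prescribed c t
        unprescribed {c} p with Cc , e ← prescribed⇒ p = t∉ c Cc e

        C⇒∉S : ∀ {c} → C c ≡ true → S c ≡ false
        C⇒∉S {c} Cc with ∈-dec (S c)
        ... | inj₁ Sc = true≢false Cc (proj₁ (S-free c Sc))
        ... | inj₂ f  = f

        -- In row `k` the two outermost columns are prescribed and therefore outside `S`, so an
        -- occurrence of `t` above them does not count towards `S`. The only way to have none is
        -- that `t` is due in row `K` of the odd case.
        left-seen : κ ≡ k → (∃[ c ] (toℕ c < 2 × C c ≡ true × present κ A c t ≡ true)) ⊎ (κ < K × t ∈ left K)
        left-seen refl with L.locate {κ} agL t
        ... | inj₁ (i , c , i<κ , _ , c< , e) =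
              inj₁ (c , c< , left-column (≤-trans c< (2≤width-≤k ≤-refl)) , present⁺ {k = κ} {A} i<κ e)
        ... | inj₂ (i , κ≤i , i≤K , t∈) with m≤n⇒m<n∨m≡n κ≤i
        ...   | inj₂ refl = ⊥-elim (unprescribed (inj₁ (proj₂ (L.∈⇒column i≤K t∈))))
        ...   | inj₁ κ<i  = inj₂ (≤-trans κ<i i≤K , subst (λ j → t ∈ left j) (≤-antisym i≤K (≤-trans K≤1+k κ<i)) t∈)

        right-seen : κ ≡ k → (∃[ c ] (toℕ (opposite c) < 2 × C c ≡ true × present κ A c t ≡ true)) ⊎ (κ < K × t ∈ right (swap₀₁ K))
        right-seen refl with R.locate {κ} agR t
        ... | inj₁ (i , c , i<κ , _ , c< , e) =
              inj₁ (c , c< , right-column (≤-trans c< (2≤width-≤k (swap₀₁-≤ 1≤k ≤-refl))) , present⁺ {k = κ} {A} i<κ e)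
        ... | inj₂ (i , κ≤i , i≤K , t∈) with m≤n⇒m<n∨m≡n κ≤i
        ...   | inj₂ refl = ⊥-elim (unprescribed (inj₂ (proj₂ (R.∈⇒column i≤K t∈))))
        ...   | inj₁ κ<i  = inj₂ (≤-trans κ<i i≤K , subst (λ j → t ∈ right (swap₀₁ j)) (≤-antisym i≤K (≤-trans K≤1+k κ<i)) t∈)

        S-present : ∀ c → S c ≡ true → present κ A c t ≡ true
        S-present c Sc = proj₂ (S-free c Sc)

        width-sum : 2 ≤ κ → width κ + width (swap₀₁ κ) ≡ n / suc κ + n / suc κ
        width-sum (s≤s (s≤s _)) = refl

        -- At most four cells are prescribed, and for odd `n` the count `4 + 2k` is one too large. A
        -- single occurrence of `t` above a prescribed column makes up for it; for even `n`, one is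
        -- needed at either end.
        one-column : κ ≡ k → κ < K → ∀ {c} → C c ≡ true → present κ A c t ≡ true → card C + (card S + κ) ≤ n
        one-column refl κ<K Cc pr = begin
          card C + (card S + k)         ≤⟨ +-monoˡ-≤ (card S + k) card-C ⟩
          width k + width (swap₀₁ k) + (card S + k)
                                        ≤⟨ +-monoˡ-≤ (card S + k) (≤-trans (≤-reflexive (width-sum 2≤k)) (+-mono-≤ width≤2 width≤2)) ⟩
          3 + (suc (card S) + k)        ≤⟨ +-monoʳ-≤ 3 (+-monoˡ-≤ k (columns-bound₁ RA S S-present (C⇒∉S Cc) pr)) ⟩
          3 + (k + k)                   ≡⟨ solve 1 (λ k → con 3 :+ (k :+ k) := con 1 :+ k :+ (con 1 :+ k) :+ con 1) refl k ⟩
          suc k + suc k + 1             ≤⟨ +-monoʳ-≤ (suc k + suc k) (+-cancelˡ-≤ k 1 ε (≤-trans (≤-reflexive (+-comm k 1)) κ<K)) ⟩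
          suc k + suc k + ε             ≡⟨ sym n≡ ⟩
          n                             ∎
          where
          open ≤-Reasoning
          open +-*-Solver
          2≤k = ≤-trans (s≤s (s≤s z≤n)) 4≤k

        two-columns : κ ≡ k → ∀ {c c′} → c ≢ c′ → C c ≡ true → present κ A c t ≡ true →
          C c′ ≡ true → present κ A c′ t ≡ true → card C + (card S + κ) ≤ n
        two-columns refl {c} {c′} c≢c′ Cc pr Cc′ pr′ = begin
          card C + (card S + k)         ≤⟨ +-monoˡ-≤ (card S + k) card-C ⟩
          width k + width (swap₀₁ k) + (card S + k)
                                        ≤⟨ +-monoˡ-≤ (card S + k) (≤-trans (≤-reflexive (width-sum 2≤k)) (+-mono-≤ width≤2 width≤2)) ⟩
          2 + (suc (suc (card S)) + k)  ≡⟨ cong (λ z → 2 + (suc z + k)) (sym (card-∷ S c (C⇒∉S Cc))) ⟩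
          2 + (suc (card S⁺) + k)       ≤⟨ +-monoʳ-≤ 2 (+-monoˡ-≤ k (columns-bound₁ RA S⁺ S⁺-present c′∉ pr′)) ⟩
          2 + (k + k)                   ≡⟨ solve 1 (λ k → con 2 :+ (k :+ k) := con 1 :+ k :+ (con 1 :+ k)) refl k ⟩
          suc k + suc k                 ≤⟨ m≤m+n (suc k + suc k) ε ⟩
          suc k + suc k + ε             ≡⟨ sym n≡ ⟩
          n                             ∎
          where
          open ≤-Reasoning
          open +-*-Solver
          2≤k = ≤-trans (s≤s (s≤s z≤n)) 4≤k
          S⁺ : FinSet n
          S⁺ i = S i ∨ ⌊ i F.≟ c ⌋
          S⁺-present : ∀ i → S⁺ i ≡ true → present k A i t ≡ true
          S⁺-present i h with S i in eq | i F.≟ c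
          ... | true  | _        = S-present i eq
          ... | false | yes refl = pr
          S⁺-present i () | false | no _
          c′∉ : S⁺ c′ ≡ false
          c′∉ = cong₂ _∨_ (C⇒∉S Cc′) (not-true (≟-false (c≢c′ ∘ sym)))

        room : ∀ {c₀} → S c₀ ≡ true → card C + (card S + κ) ≤ n
        room {c₀} Sc₀ with 2 ≤? κ
        -- The first two rows are prescribed entirely, so no free column exists.
        ... | no κ<2 = true≢false (full (first-rows κ (≤-pred (≰⇒> κ<2))) c₀) (proj₁ (S-free c₀ Sc₀))
          where
          first-rows : ∀ κ → κ ≤ 1 → width κ + width (swap₀₁ κ) ≡ n
          first-rows zero       _ = half+half
          first-rows (suc zero) _ = trans (+-comm (n / 2) half) half+half
          first-rows (suc (suc _)) (s≤s ())
        ... | yes 2≤κ with m≤n⇒m<n∨m≡n κ≤k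
        ...   | inj₁ κ<k = ≤-trans (+-mono-≤ card-C (+-monoˡ-≤ κ (columns-bound RA S S-present)))
                (≤-trans (≤-reflexive (cong (_+ (κ + κ)) (width-sum 2≤κ))) (prescribed-bound 2≤κ κ<k {n / suc κ} (m/n*n≤m n (suc κ))))
        ...   | inj₂ κ≡k with left-seen κ≡k | right-seen κ≡k
        ...     | inj₁ (c , c< , Cc , pr) | inj₁ (c′ , c′< , Cc′ , pr′) = two-columns κ≡k apart Cc pr Cc′ pr′
          where
          apart : c ≢ c′
          -- A column within two of both edges would force `n ≤ 3`.
          apart refl = <⇒≱ (≤-trans (s≤s (s≤s (s≤s (s≤s z≤n)))) 10≤n)
            (subst (_≤ 3) (opposite-sum c) (s≤s (+-mono-≤ (≤-pred c<) (≤-pred c′<))))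
        ...     | inj₁ (c , _ , Cc , pr) | inj₂ (κ<K , _) = one-column κ≡k κ<K Cc pr
        ...     | inj₂ (κ<K , _) | inj₁ (c , _ , Cc , pr) = one-column κ≡k κ<K Cc pr
        -- The last table rows of the two sides are disjoint, so `t` cannot be due in both.
        ...     | inj₂ (_ , t∈) | inj₂ (_ , t∈′) = ⊥-elim (disjoint ≤-refl t∈ t∈′)

      extended : Σ (NewRow κ A) λ r → ∀ c → C c ≡ true → NewRow.row r c ≡ v c
      extended = extend-row-prescribed RA C v v-injective fresh Room.room

      new-row : NewRow κ A
      new-row = proj₁ extended

      new-row-agrees : ∀ {c s} → Prescribed c s → NewRow.row new-row c ≡ s
      new-row-agrees {c} p with Cc , e ← prescribed⇒ p = trans (proj₂ extended c Cc) e

    prescribed-rows : ∀ κ → κ ≤ suc k → Σ (Rows n) λ A → Rectangle κ A × L.Agrees κ A × R.Agrees κ A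
    prescribed-rows zero _ = (λ _ c → c) , record { row-injective = λ () ; col-injective = λ () } , (λ ()) , λ ()
    prescribed-rows (suc κ) (s≤s κ≤k) with A , RA , agL , agR ← prescribed-rows κ (m≤n⇒m≤1+n κ≤k) =
      A [ κ ≔ g ] , Rectangle-≔ RA new-row , agreesL , agreesR
      where
      open Row κ≤k RA agL agR
      g = NewRow.row new-row
      agreesL : L.Agrees (suc κ) (A [ κ ≔ g ])
      agreesL (s≤s i≤κ) {c} p with m≤n⇒m<n∨m≡n i≤κ
      ... | inj₁ i<κ rewrite ≔-old A {g = g} i<κ = agL i<κ p
      ... | inj₂ refl rewrite ≔-new A {κ} {g} = new-row-agrees (inj₁ p)
      agreesR : R.Agrees (suc κ) (A [ κ ≔ g ])
      agreesR (s≤s i≤κ) {c} p with m≤n⇒m<n∨m≡n i≤κ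
      ... | inj₁ i<κ rewrite ≔-old A {g = g} i<κ = agR i<κ p
      ... | inj₂ refl rewrite ≔-new A {κ} {g} = new-row-agrees (inj₂ p)

    -- The row after the first half and the completed square

    complete : ∀ d {j} {A : Rows n} → Rectangle j A → j + d ≡ n → Σ (Rows n) λ B → Rectangle n B × (∀ {i} → i < j → B i ≡ A i)
    complete zero {j} {A} RA e = A , subst (λ j → Rectangle j A) (trans (sym (+-identityʳ j)) e) RA , λ _ → refl
    complete (suc d) {j} {A} RA e
      with r ← extend-row (subst (j <_) e (m<m+n j (s≤s z≤n))) RA
      with B , RB , same ← complete d (Rectangle-≔ RA r) (trans (sym (+-suc j d)) e) =
      B , RB , λ i<j → trans (same (m≤n⇒m≤1+n i<j)) (≔-old A i<j)

    -- Vacuous for even `n`. For odd `n` it concerns row `K` alone, whose symbol has to be in one of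
    -- the two outermost columns but not in its exact slot.
    LastWindow : {D : Table} → (Fin n → ℕ) → Rows n → Set
    LastWindow {D} slot A = ∀ {i s} → suc k ≤ i → i ≤ K → s ∈ D i → ∃[ c ] (slot c < 2 × A i c ≡ s)

    Good : ℕ → Rows n → Set
    Good j A = Rectangle j A × L.Agrees (suc k) A × R.Agrees (suc k) A ×
      LastWindow {left} toℕ A × LastWindow {right ∘ swap₀₁} (toℕ ∘ opposite) A

    record Start : Set where
      field
        rows      : Rows n
        rectangle : Rectangle (suc k) rows
        agreesL   : L.Agrees (suc k) rows
        agreesR   : R.Agrees (suc k) rows

    even-end : K ≡ k → Start → ∃[ j ] (suc K ≤ j × j ≤ n × Σ (Rows n) (Good j))
    even-end K≡ start =
      suc k , s≤s (≤-reflexive K≡) , subst (suc k ≤_) (sym n≡) (≤-trans (m≤m+n (suc k) (suc k)) (m≤m+n (suc k + suc k) ε)) ,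
      rows , rectangle , agreesL , agreesR , none , none
      where
      open Start start
      none : ∀ {X Y : Set} {i} → suc k ≤ i → i ≤ K → X → Y
      none k<i i≤K _ = contradiction (subst (suc k ≤_) K≡ (≤-trans k<i i≤K)) (<⇒≱ ≤-refl)

    Windows : Rows n → Fin n → Fin n → Set
    Windows A x y = Σ (NewRow (suc k) A) λ r → ∀ c →
      (NewRow.row r c ≡ x → L.window 2 c ≡ true) × (NewRow.row r c ≡ y → R.window 2 c ≡ true)

    odd-size : K ≡ suc k → suc (suc k + suc k) ≤ n
    odd-size K≡ = ≤-reflexive (trans (trans (+-comm 1 (suc k + suc k)) (cong (suc k + suc k +_) (sym ε≡1))) (sym n≡))
      where
      ε≡1 : ε ≡ 1
      ε≡1 = +-cancelˡ-≡ k ε 1 (trans K≡ (+-comm 1 k))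

    windowed-row : K ≡ suc k → (start : Start) → ∀ {x y} →
      x ∈ left K → (∀ {t} → t ∈ left K → t ≡ x) → y ∈ right (swap₀₁ K) → Windows (Start.rows start) x y
    windowed-row K≡ start {x} {y} x∈ x-only y∈ =
      extend-row-windows rectangle (odd-size K≡) (L.window 2) (R.window 2) (L.card-window-≥ 2≤n)
        (≤-trans (s≤s z≤n) (R.card-window-≥ 2≤n)) x y (λ { refl → disjoint ≤-refl x∈ y∈ })
        (L.absent-last agreesL K≡ x∈) (R.absent-last agreesR K≡ y∈)
        (λ t t≢x → L.seen-before-last agreesL K≡ (t≢x ∘ x-only))
      where
      open Start start
      2≤n : 2 ≤ n
      2≤n = ≤-trans (s≤s (s≤s z≤n)) 10≤n

    odd-end : K ≡ suc k → (start : Start) → ∀ {x y} →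
      (∀ {t} → t ∈ left K → t ≡ x) → (∀ {t} → t ∈ right (swap₀₁ K) → t ≡ y) →
      Windows (Start.rows start) x y →
      ∃[ j ] (suc K ≤ j × j ≤ n × Σ (Rows n) (Good j))
    odd-end K≡ start {x} {y} x-only y-only (r , windows) =
      suc (suc k) , s≤s K≤1+k , ≤-trans (s≤s (m≤m+n (suc k) (suc k))) (odd-size K≡) ,
      B , Rectangle-≔ rectangle r ,
      (λ {i} i< {c} p → trans (cong (λ f → f c) (≔-old rows i<)) (agreesL i< p)) ,
      (λ {i} i< {c} p → trans (cong (λ f → f c) (≔-old rows i<)) (agreesR i< p)) ,
      lastL , lastR
      where
      open Start start
      open NewRow r renaming (row to g)
      B : Rows n
      B = rows [ suc k ≔ g ]
      position : ∀ s → ∃[ c ] g c ≡ s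
      position = injective⇒surjective g injective
      is-last : ∀ {i} → suc k ≤ i → i ≤ K → i ≡ K
      is-last k<i i≤K = ≤-antisym i≤K (≤-trans K≤1+k k<i)
      B-last : ∀ {i c} → suc k ≤ i → i ≤ K → B i c ≡ g c
      B-last {i} {c} k<i i≤K = trans (cong (λ j → B j c) (trans (is-last k<i i≤K) K≡)) (cong (λ f → f c) (≔-new rows {suc k} {g}))
      lastL : LastWindow {left} toℕ B
      lastL {i} {s} k<i i≤K s∈ with c , e ← position s =
        c , L.window⁻ {2} (proj₁ (windows c) (trans e (x-only (subst (λ j → s ∈ left j) (is-last k<i i≤K) s∈)))) ,
        trans (B-last k<i i≤K) e
      lastR : LastWindow {right ∘ swap₀₁} (toℕ ∘ opposite) B
      lastR {i} {s} k<i i≤K s∈ with c , e ← position s =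
        c , R.window⁻ {2} (proj₂ (windows c) (trans e (y-only (subst (λ j → s ∈ right (swap₀₁ j)) (is-last k<i i≤K) s∈)))) ,
        trans (B-last k<i i≤K) e

    windowed : ∃[ j ] (suc K ≤ j × j ≤ n × Σ (Rows n) (Good j))
    windowed = decide (m≤n⇒m<n∨m≡n k≤K)
      where
      start : Start
      start = let A , RA , agL , agR = prescribed-rows (suc k) ≤-refl in
        record { rows = A ; rectangle = RA ; agreesL = agL ; agreesR = agR }
      decide : k < K ⊎ k ≡ K → ∃[ j ] (suc K ≤ j × j ≤ n × Σ (Rows n) (Good j))
      decide (inj₂ e)   = even-end (sym e) start
      decide (inj₁ k<K) = odd-end K≡ start (proj₂ (proj₂ l)) (proj₂ (proj₂ r))
        (windowed-row K≡ start (proj₁ (proj₂ l)) (proj₂ (proj₂ l)) (proj₁ (proj₂ r)))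
        where
        K≡ = ≤-antisym K≤1+k k<K
        l = L.last-entry K≡
        r = R.last-entry K≡

    complete-good : ∃[ j ] (suc K ≤ j × j ≤ n × Σ (Rows n) (Good j)) → Σ (Rows n) (Good n)
    complete-good (j , K<j , j≤n , A , RA , agL , agR , lastL , lastR)
      with B , RB , same ← complete (n ∸ j) RA (m+[n∸m]≡n j≤n) =
      B , RB
      , (λ {i} i< {c} p → trans (cong (λ f → f c) (same (early i<))) (agL i< p))
      , (λ {i} i< {c} p → trans (cong (λ f → f c) (same (early i<))) (agR i< p))
      , (λ k<i i≤K s∈ → let c , c< , e = lastL k<i i≤K s∈ in
          c , c< , trans (cong (λ f → f c) (same (≤-trans (s≤s i≤K) K<j))) e)
      , (λ k<i i≤K s∈ → let c , c< , e = lastR k<i i≤K s∈ in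
          c , c< , trans (cong (λ f → f c) (same (≤-trans (s≤s i≤K) K<j))) e)
      where
      early : ∀ {i} → i < suc k → i < j
      early i< = ≤-trans i< (≤-trans (s≤s k≤K) K<j)

    good-array : Σ (Rows n) (Good n) → ∃[ A ] LRPA₁₂ {n} A
    good-array (A , RA , agL , agR , lastL , lastR) =
      (λ r → A (toℕ r)) , (rows , cols) , (rows , upper-left) , (rows , upper-right)
      where
      open Rectangle RA
      rows : RowsArePerms (λ r → A (toℕ r))
      rows r = injective⇒bijective (A (toℕ r)) (row-injective (F.toℕ<n r))
      cols : ColsArePerms (λ r → A (toℕ r))
      cols c = injective⇒bijective (λ r → A (toℕ r) c) λ {r} {r′} e → F.toℕ-injective (col-injective (F.toℕ<n r) (F.toℕ<n r′) e)
      row-index : ∀ {i j} → i ≤ j → j < n → ∃[ r ] toℕ {n} r ≡ i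
      row-index i≤j j<n = toℕ-column (≤-trans (s≤s i≤j) j<n)
      upper-left : UpperLeftCond (λ r → A (toℕ r))
      upper-left j j<n s with i , c , i≤j , c< , e ← L.covered RA agL lastL j j<n s
        with r , refl ← row-index i≤j j<n = r , c , s≤s i≤j , c< , e
      upper-right : UpperRightCond (λ r → A (toℕ r))
      upper-right j j<n s with i , c , i≤j , c< , e ← R.covered RA agR lastR j j<n s
        with r , refl ← row-index i≤j j<n = r , c , s≤s i≤j , right-end , e
        where
        right-end : n ∸ ⌈ n /suc j ⌉ ≤ toℕ c
        right-end = m≤n+o⇒m∸n≤o n ⌈ n /suc j ⌉ (≤-trans (≤-reflexive (trans (sym (opposite-sum c))
          (cong suc (+-comm (toℕ c) _)))) (+-monoˡ-≤ (toℕ c) c<))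

    array : ∃[ A ] LRPA₁₂ {n} A
    array = good-array (complete-good windowed)

large-array : ∀ n → 10 ≤ n → ∃[ A ] LRPA₁₂ {n} A
large-array n 10≤n = array
  where
  open +-*-Solver
  5≤n/2 : 5 ≤ n / 2
  5≤n/2 = /-monoˡ-≤ 2 10≤n
  k = n / 2 ∸ 1
  k≡ : suc k ≡ n / 2
  k≡ = m+[n∸m]≡n (≤-trans (s≤s z≤n) 5≤n/2)
  n≡ : n ≡ suc k + suc k + n % 2
  n≡ = trans (m≡m%n+[m/n]*n n 2) (trans (cong (λ h → n % 2 + h * 2) (sym k≡))
    (solve 2 (λ k ε → ε :+ (con 1 :+ k) :* con 2 := con 1 :+ k :+ (con 1 :+ k) :+ ε) refl k (n % 2)))
  open Completion n k (n % 2) (∸-monoˡ-≤ 1 5≤n/2) (≤-pred (m%n<n n 2)) n≡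
  open Assembly (subst (Tables.Tables₂ n) (m+[n∸m]≡n (<⇒≤ 2≤K)) (Tables.tables n shrinks (K ∸ 1)))

-- Orders up to 9

-- The conditions with the order ranging over `Fin n`, so that they can be decided by evaluation.
-- Injectivity replaces bijectivity, as the index set is finite.
Checks : ∀ {n} → Array n → Set
Checks {n} A =
  (∀ r c c′ → A r c ≡ A r c′ → c ≡ c′) ×
  (∀ c r r′ → A r c ≡ A r′ c → r ≡ r′) ×
  (∀ (k s : Fin n) → ∃[ r ] ∃[ c ] (toℕ r < suc (toℕ k) × toℕ c < ⌈ n /suc toℕ k ⌉ × A r c ≡ s)) ×
  (∀ (k s : Fin n) → ∃[ r ] ∃[ c ] (toℕ r < suc (toℕ k) × n ∸ ⌈ n /suc toℕ k ⌉ ≤ toℕ c × A r c ≡ s))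

checks? : ∀ {n} (A : Array n) → Dec (Checks A)
checks? {n} A =
  (F.all? λ r → F.all? λ c → F.all? λ c′ → (A r c F.≟ A r c′) →-dec (c F.≟ c′)) ×-dec
  (F.all? λ c → F.all? λ r → F.all? λ r′ → (A r c F.≟ A r′ c) →-dec (r F.≟ r′)) ×-dec
  (F.all? λ k → F.all? λ s → F.any? λ r → F.any? λ c →
    (toℕ r <? suc (toℕ k)) ×-dec (toℕ c <? ⌈ n /suc toℕ k ⌉) ×-dec (A r c F.≟ s)) ×-dec
  (F.all? λ k → F.all? λ s → F.any? λ r → F.any? λ c →
    (toℕ r <? suc (toℕ k)) ×-dec (n ∸ ⌈ n /suc toℕ k ⌉ ≤? toℕ c) ×-dec (A r c F.≟ s))

fromVec : ∀ {m} → Vec (Vec ℕ (suc m)) (suc m) → Array (suc m)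
fromVec {m} V r c = lookup (lookup V r) c mod suc m

small-array : ∀ {m} (V : Vec (Vec ℕ (suc m)) (suc m)) → {True (checks? (fromVec V))} → ∃[ A ] LRPA₁₂ {suc m} A
small-array {m} V {ok} with rows , cols , upper-left , upper-right ← toWitness ok =
  fromVec V , (rows′ , λ c → injective⇒bijective _ (λ {r} {r′} → cols c r r′)) ,
  (rows′ , λ k k<n s → subst Left (F.toℕ-fromℕ< k<n) (upper-left (fromℕ< k<n)) s) ,
  (rows′ , λ k k<n s → subst Right (F.toℕ-fromℕ< k<n) (upper-right (fromℕ< k<n)) s)
  where
  rows′ : RowsArePerms (fromVec V)
  rows′ r = injective⇒bijective _ (λ {c} {c′} → rows r c c′)
  Left Right : ℕ → Set
  Left k = ∀ s → ∃[ r ] ∃[ c ] (toℕ r < suc k × toℕ c < ⌈ suc m /suc k ⌉ × fromVec V r c ≡ s)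
  Right k = ∀ s → ∃[ r ] ∃[ c ] (toℕ r < suc k × suc m ∸ ⌈ suc m /suc k ⌉ ≤ toℕ c × fromVec V r c ≡ s)

theorem3p4 : ∀ (m : ℕ) → ∃[ A ] LRPA₁₂ {suc m} A
theorem3p4 0 = small-array (
  (0 ∷ []) ∷ [])
theorem3p4 1 = small-array (
  (1 ∷ 0 ∷ []) ∷
  (0 ∷ 1 ∷ []) ∷ [])
theorem3p4 2 = small-array (
  (2 ∷ 0 ∷ 1 ∷ []) ∷
  (1 ∷ 2 ∷ 0 ∷ []) ∷
  (0 ∷ 1 ∷ 2 ∷ []) ∷ [])
theorem3p4 3 = small-array (
  (0 ∷ 3 ∷ 1 ∷ 2 ∷ []) ∷
  (2 ∷ 1 ∷ 3 ∷ 0 ∷ []) ∷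
  (3 ∷ 0 ∷ 2 ∷ 1 ∷ []) ∷
  (1 ∷ 2 ∷ 0 ∷ 3 ∷ []) ∷ [])
theorem3p4 4 = small-array (
  (2 ∷ 1 ∷ 0 ∷ 4 ∷ 3 ∷ []) ∷
  (4 ∷ 3 ∷ 2 ∷ 0 ∷ 1 ∷ []) ∷
  (0 ∷ 4 ∷ 3 ∷ 1 ∷ 2 ∷ []) ∷
  (1 ∷ 2 ∷ 4 ∷ 3 ∷ 0 ∷ []) ∷
  (3 ∷ 0 ∷ 1 ∷ 2 ∷ 4 ∷ []) ∷ [])
theorem3p4 5 = small-array (
  (2 ∷ 5 ∷ 3 ∷ 0 ∷ 1 ∷ 4 ∷ []) ∷
  (4 ∷ 0 ∷ 1 ∷ 2 ∷ 3 ∷ 5 ∷ []) ∷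
  (1 ∷ 3 ∷ 4 ∷ 5 ∷ 0 ∷ 2 ∷ []) ∷
  (3 ∷ 4 ∷ 5 ∷ 1 ∷ 2 ∷ 0 ∷ []) ∷
  (0 ∷ 1 ∷ 2 ∷ 4 ∷ 5 ∷ 3 ∷ []) ∷
  (5 ∷ 2 ∷ 0 ∷ 3 ∷ 4 ∷ 1 ∷ []) ∷ [])
theorem3p4 6 = small-array (
  (5 ∷ 0 ∷ 2 ∷ 3 ∷ 4 ∷ 1 ∷ 6 ∷ []) ∷
  (4 ∷ 6 ∷ 1 ∷ 5 ∷ 3 ∷ 0 ∷ 2 ∷ []) ∷
  (3 ∷ 4 ∷ 0 ∷ 1 ∷ 6 ∷ 2 ∷ 5 ∷ []) ∷
  (1 ∷ 2 ∷ 5 ∷ 6 ∷ 0 ∷ 3 ∷ 4 ∷ []) ∷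
  (6 ∷ 3 ∷ 4 ∷ 0 ∷ 2 ∷ 5 ∷ 1 ∷ []) ∷
  (2 ∷ 1 ∷ 3 ∷ 4 ∷ 5 ∷ 6 ∷ 0 ∷ []) ∷
  (0 ∷ 5 ∷ 6 ∷ 2 ∷ 1 ∷ 4 ∷ 3 ∷ []) ∷ [])
theorem3p4 7 = small-array (
  (2 ∷ 3 ∷ 4 ∷ 1 ∷ 7 ∷ 5 ∷ 6 ∷ 0 ∷ []) ∷
  (0 ∷ 5 ∷ 7 ∷ 6 ∷ 2 ∷ 3 ∷ 4 ∷ 1 ∷ []) ∷
  (1 ∷ 6 ∷ 3 ∷ 5 ∷ 4 ∷ 0 ∷ 7 ∷ 2 ∷ []) ∷
  (4 ∷ 7 ∷ 2 ∷ 0 ∷ 1 ∷ 6 ∷ 5 ∷ 3 ∷ []) ∷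
  (5 ∷ 0 ∷ 1 ∷ 4 ∷ 3 ∷ 7 ∷ 2 ∷ 6 ∷ []) ∷
  (7 ∷ 2 ∷ 6 ∷ 3 ∷ 5 ∷ 1 ∷ 0 ∷ 4 ∷ []) ∷
  (3 ∷ 4 ∷ 0 ∷ 7 ∷ 6 ∷ 2 ∷ 1 ∷ 5 ∷ []) ∷
  (6 ∷ 1 ∷ 5 ∷ 2 ∷ 0 ∷ 4 ∷ 3 ∷ 7 ∷ []) ∷ [])
theorem3p4 8 = small-array (
  (0 ∷ 4 ∷ 5 ∷ 3 ∷ 8 ∷ 6 ∷ 1 ∷ 2 ∷ 7 ∷ []) ∷
  (2 ∷ 7 ∷ 6 ∷ 1 ∷ 5 ∷ 0 ∷ 3 ∷ 4 ∷ 8 ∷ []) ∷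
  (1 ∷ 8 ∷ 3 ∷ 2 ∷ 7 ∷ 4 ∷ 0 ∷ 5 ∷ 6 ∷ []) ∷
  (3 ∷ 5 ∷ 8 ∷ 7 ∷ 2 ∷ 1 ∷ 4 ∷ 6 ∷ 0 ∷ []) ∷
  (7 ∷ 6 ∷ 0 ∷ 5 ∷ 4 ∷ 8 ∷ 2 ∷ 1 ∷ 3 ∷ []) ∷
  (5 ∷ 3 ∷ 4 ∷ 0 ∷ 1 ∷ 7 ∷ 6 ∷ 8 ∷ 2 ∷ []) ∷
  (6 ∷ 0 ∷ 1 ∷ 4 ∷ 3 ∷ 2 ∷ 8 ∷ 7 ∷ 5 ∷ []) ∷
  (4 ∷ 2 ∷ 7 ∷ 8 ∷ 6 ∷ 3 ∷ 5 ∷ 0 ∷ 1 ∷ []) ∷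
  (8 ∷ 1 ∷ 2 ∷ 6 ∷ 0 ∷ 5 ∷ 7 ∷ 3 ∷ 4 ∷ []) ∷ [])
theorem3p4 (suc (suc (suc (suc (suc (suc (suc (suc (suc m))))))))) =
  large-array (10 + m) (m≤m+n 10 m)
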